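{- There exists a positive integer $d$ such that $\mathrm{Gr}(2) \le \mathrm{TTT}(4,2,d) + 1$; for example, $d = 2\uparrow\uparrow 18$ works.
   Context: For a finite alphabet $A$ with $|A|\ge 2$ and a group $G$ acting on $A$, a $k$-parameter subset of $A^n$ is the image of an injective map $f : A^k \to A^n$ such that for each coordinate $1 \le i \le n$, either $f_i(x_1,\dots,x_k) = a$ for some constant $a \in A$, or $f_i(x_1,\dots,x_k) = \sigma(x_j)$ for some $1\le j\le k$ and some $\sigma \in G$. Tic-tac-toe numbers: take $A = [t]$ and $G = \{e,\pi\}$ with $e(x)=x$, $\pi(x) = t+1-x$; a $d$-parameter subset of $[t]^n$ is a $d$-dimensional tic-tac-toe space, and $\mathrm{TTT}(t,k,d)$ is the least $n$ such that every $k$-coloring of the points of $[t]^n$ contains a monochromatic $d$-dimensional tic-tac-toe space. Graham numbers: take $A = \{\pm 1\}$ and $G = \{x\mapsto x, x \mapsto -x\}$; a $d$-parameter subset of $\{\pm1\}^n$ is a $d$-dimensional subcube. An edge-coloring of $\{\pm1\}^n$ is a $2$-coloring of the edges of the complete graph on $\{\pm1\}^n$. $\mathrm{Gr}(2)$ is the least $n$ such that every edge-coloring of $\{\pm1\}^n$ contains a $2$-dimensional subcube all $6$ of whose edges have the same color. Knuth up-arrow notation: $a\uparrow b = a^b$, and $a \uparrow\uparrow b = a\uparrow(a\uparrow(\cdots\uparrow a))$ with $b$ copies of $a$ (a right-associated tower of height $b$). -}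

module Defs where

open import Data.Nat using (ℕ; zero; suc; _+_; _^_; _≤_; _<_)
open import Data.Fin using (Fin; zero; suc; opposite)
open import Data.Bool using (Bool; true; false; not)
open import Data.Vec using (Vec; map; lookup)
open import Data.Product using (Σ; _×_; ∃; ∃-syntax)
open import Relation.Binary.PropositionalEquality using (_≡_; _≢_)
open import Function.Definitions using (Injective)

_↑↑_ : ℕ → ℕ → ℕ
a ↑↑ zero = 1
a ↑↑ suc b = a ^ (a ↑↑ b)

IsLeast : (ℕ → Set) → ℕ → Set
IsLeast P n = P n × (∀ m → P m → n ≤ m)

-- General k-parameter subsets of A^n, for a group G acting on A,
-- given by an indexing type I of group elements and the action act.

data Entry (A : Set) (I : Set) (k : ℕ) : Set where
  const : A → Entry A I k
  var   : I → Fin k → Entry A I k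

evalEntry : {A I : Set} {k : ℕ} → (I → A → A) → Entry A I k → Vec A k → A
evalEntry act (const a) x = a
evalEntry act (var σ j) x = act σ (lookup x j)

paramMap : {A I : Set} {k n : ℕ} → (I → A → A) → Vec (Entry A I k) n → Vec A k → Vec A n
paramMap act spec x = map (λ e → evalEntry act e x) spec

-- A k-parameter map: a map of the above shape that is injective
-- (its image is a k-parameter subset of A^n)
IsParamMap : {A I : Set} {k n : ℕ} → (I → A → A) → (Vec A k → Vec A n) → Set
IsParamMap {A} {I} {k} {n} act f =
  Σ (Vec (Entry A I k) n) (λ spec → (∀ x → f x ≡ paramMap act spec x)) × Injective _≡_ _≡_ f

-- Tic-tac-toe: A = [t] = Fin t, G = {e, π}, π(x) = t+1-x (i.e. Fin.opposite)

tttAct : {t : ℕ} → Bool → Fin t → Fin t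
tttAct false x = x
tttAct true  x = opposite x

TTTProp : ℕ → ℕ → ℕ → ℕ → Set
TTTProp t k d n =
  (c : Vec (Fin t) n → Fin k) →
  ∃[ f ] (IsParamMap {Fin t} {Bool} {d} {n} tttAct f × ∃[ col ] (∀ x → c (f x) ≡ col))

IsTTT : ℕ → ℕ → ℕ → ℕ → Set
IsTTT t k d = IsLeast (TTTProp t k d)

-- Graham: A = {±1} (encoded as Bool, with -1 ↦ flip), G = {x ↦ x, x ↦ -x}

grAct : Bool → Bool → Bool
grAct false x = x
grAct true  x = not x

-- A 2-colouring of the edges of the complete graph on {±1}^n:
-- a symmetric colour function on pairs (values on u = u are irrelevant).
EdgeColouring : ℕ → Set
EdgeColouring n = Σ (Vec Bool n → Vec Bool n → Fin 2) (λ c → ∀ u v → c u v ≡ c v u)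

GrProp : ℕ → Set
GrProp n =
  (ec : EdgeColouring n) →
  ∃[ f ] (IsParamMap {Bool} {Bool} {2} {n} grAct f ×
          ∃[ col ] (∀ x y → x ≢ y → Σ.proj₁ ec (f x) (f y) ≡ col))

IsGr2 : ℕ → Set
IsGr2 = IsLeast GrProp

GrBound : ℕ → Set
GrBound d = ∃[ g ] ∃[ T ] (IsGr2 g × IsTTT 4 2 d T × g ≤ T + 1)

{-# OPTIONS --safe #-}
-- Reading a letter of [4] as a pair of signs turns a word of [4]^n into a pair (u , v) of vertices of
-- {±1}^n, that is, into the edge from (+1 , u) to (-1 , v) of {±1}^(n+1). A monochromatic d-dimensional
-- tic-tac-toe space thus yields two parallel d-cubes all of whose cross edges have one colour c. If for
-- some direction δ in {-1,0,1}^d both cubes contain an edge of colour c in direction δ, these two edges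
-- span a monochromatic square. Otherwise each direction is avoided by c in one of the two cubes, which
-- 2-colours the directions, and α, β with disjoint supports such that α, β, α + β, α - β have equal
-- colours give a square in that cube with all edges of the other colour. Such α, β exist for large d:
-- by Ramsey's theorem for pairs the colours of eᵢ, eᵢ + eⱼ and eᵢ - eⱼ may be assumed independent of
-- i < j, and then a finite case check in dimension 7 suffices. The number TTT(4,2,d) exists by the
-- Hales–Jewett theorem over the alphabet [4]^d, and least elements exist by exhaustive search.
module Submission where

open import Defs
open import Data.Bool using (Bool; true; false; not; _∧_; _∨_; _xor_; if_then_else_)
import Data.Bool.Properties as Bool
open import Data.Empty using (⊥; ⊥-elim)
open import Data.Fin using (Fin; zero; suc; funToFin; finToFun; opposite)
import Data.Fin.Properties as Fin
open import Data.List using (List; []; _∷_; concatMap)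
import Data.List as List
open import Data.List.Relation.Unary.All using (All; []; _∷_)
import Data.List.Relation.Unary.All as All
import Data.List.Relation.Unary.All.Properties as All
open import Data.Maybe using (Maybe; just; nothing; fromMaybe; Is-just)
import Data.Maybe as Maybe
import Data.Maybe.Properties as Maybe
open import Data.Maybe.Relation.Unary.Any using (just)
open import Data.Nat using (ℕ; zero; suc; _+_; _*_; _^_; _≤_; _<_; z≤n; s≤s; _/_; _%_)
import Data.Nat.Properties as ℕ
open import Data.Product using (_×_; _,_; proj₁; proj₂; ∃; ∃-syntax; uncurry; curry)
open import Data.Sum using (_⊎_; inj₁; inj₂; [_,_]′)
open import Data.Unit using (tt)
open import Data.Vec using (Vec; []; _∷_; _++_; map; lookup; tabulate; concat; zipWith; replicate)
import Data.Vec.Properties as Vec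
open import Data.Vec.Relation.Unary.Any using (Any; here; there; any?)
open import Function using (_∘_; id; Injective; Inverse; _↔_)
open import Relation.Binary using (DecidableEquality)
open import Relation.Binary.PropositionalEquality using (_≡_; _≢_; _≗_; refl; sym; trans; cong; cong₂; subst; subst₂)
open import Relation.Nullary using (Dec; yes; no; ¬_; does)
open import Relation.Nullary.Decidable using (map′; _×-dec_; _→-dec_; ¬?; ⌊_⌋)
open import Relation.Unary using (Decidable)

-- Finite types and decidability

-- Directions suffice because base points do not matter. The two parallel edges of a prism may start
-- at unrelated points u and v of their cubes: a coordinate where u and v agree is constant, and one
-- where they differ is plus or minus the coordinate that separates the cubes. Since negation
-- belongs to Graham's group, the four endpoints form a subcube, and its remaining four edges are
-- cross edges. Conversely, a direction in which a cube has no edge of colour c is avoided at every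
-- base point. A square spanned by α and β has two sides along α, two along β, and diagonals along α
-- + β and α - β, so avoiding these four directions leaves the other colour for all six edges,
-- wherever the square is placed.

record Finite (X : Set) : Set where
  field
    size          : ℕ
    encode        : X → Fin size
    decode        : Fin size → X
    -- A retraction is enough: a search through the codes reaches every element, and equal codes
    -- come from equal elements.
    decode-encode : ∀ x → decode (encode x) ≡ x

  encode-injective : Injective _≡_ _≡_ encode
  encode-injective {x} {y} eq = trans (sym (decode-encode x)) (trans (cong decode eq) (decode-encode y))

  infix 4 _≟_
  _≟_ : DecidableEquality X
  x ≟ y = map′ encode-injective (cong encode) (encode x Fin.≟ encode y)

  exists? : ∀ {P : X → Set} → Decidable P → Dec (∃ P)
  exists? {P} P? = map′ (λ (i , p) → decode i , p)
                        (λ (x , p) → encode x , subst P (sym (decode-encode x)) p)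
                        (Fin.any? (P? ∘ decode))

  forall? : ∀ {P : X → Set} → Decidable P → Dec (∀ x → P x)
  forall? {P} P? = map′ (λ f x → subst P (decode-encode x) (f (encode x))) (_∘ decode)
                        (Fin.all? (P? ∘ decode))

open Finite using (size; exists?; forall?)

retract : ∀ {X Y : Set} (f : X → Y) (g : Y → X) → (∀ x → g (f x) ≡ x) → Finite Y → Finite X
retract f g gf Y = record
  { size = size Y ; encode = encode ∘ f ; decode = g ∘ decode
  ; decode-encode = λ x → trans (cong g (decode-encode (f x))) (gf x) }
  where open Finite Y using (encode; decode; decode-encode)

finite-↔ : ∀ {X n} → Fin n ↔ X → Finite X
finite-↔ {n = n} f = record
  { size = n ; encode = Inverse.from f ; decode = Inverse.to f ; decode-encode = Inverse.strictlyInverseˡ f }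

finite-Fin : ∀ n → Finite (Fin n)
finite-Fin n = record { size = n ; encode = id ; decode = id ; decode-encode = λ _ → refl }

finite-Bool : Finite Bool
finite-Bool = finite-↔ Fin.2↔Bool

finite-× : ∀ {X Y} → Finite X → Finite Y → Finite (X × Y)
finite-× X Y = retract (λ (x , y) → encode X x , encode Y y) (λ (i , j) → decode X i , decode Y j)
  (λ (x , y) → cong₂ _,_ (decode-encode X x) (decode-encode Y y)) (finite-↔ (Fin.*↔× {size X} {size Y}))
  where open Finite

finite-⊎ : ∀ {X Y} → Finite X → Finite Y → Finite (X ⊎ Y)
finite-⊎ X Y = retract
  (λ { (inj₁ x) → inj₁ (encode X x) ; (inj₂ y) → inj₂ (encode Y y) })
  (λ { (inj₁ i) → inj₁ (decode X i) ; (inj₂ j) → inj₂ (decode Y j) })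
  (λ { (inj₁ x) → cong inj₁ (decode-encode X x) ; (inj₂ y) → cong inj₂ (decode-encode Y y) })
  (finite-↔ (Fin.+↔⊎ {size X} {size Y}))
  where open Finite

module _ {X Y : Set} (finX : Finite X) (finY : Finite Y) where
  private
    module X = Finite finX
    module Y = Finite finY

  encodeFun : (X → Y) → Fin (Y.size ^ X.size)
  encodeFun f = funToFin (Y.encode ∘ f ∘ X.decode)

  decodeFun : Fin (Y.size ^ X.size) → X → Y
  decodeFun i = Y.decode ∘ finToFun i ∘ X.encode

  decodeFun-encodeFun : ∀ f → decodeFun (encodeFun f) ≗ f
  decodeFun-encodeFun f x = trans
    (cong Y.decode (Fin.finToFun-funToFin (Y.encode ∘ f ∘ X.decode) (X.encode x)))
    (trans (Y.decode-encode _) (cong f (X.decode-encode x)))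

  encodeFun-injective : ∀ {f g} → encodeFun f ≡ encodeFun g → f ≗ g
  encodeFun-injective {f} {g} eq x = trans (sym (decodeFun-encodeFun f x))
    (trans (cong (λ i → decodeFun i x) eq) (decodeFun-encodeFun g x))

  -- A decoded function agrees with the original only pointwise, and without function extensionality
  -- a property need not pass along such agreement; hence `resp`.
  forallFun? : ∀ {P : (X → Y) → Set} → (∀ {f g} → f ≗ g → P f → P g) → Decidable P → Dec (∀ f → P f)
  forallFun? resp P? = map′ (λ h f → resp (decodeFun-encodeFun f) (h (encodeFun f))) (_∘ decodeFun)
                            (Fin.all? (P? ∘ decodeFun))

finite-Vec : ∀ {X} → Finite X → ∀ n → Finite (Vec X n)
finite-Vec finX n = record
  { size = _ ; encode = encodeFun (finite-Fin n) finX ∘ lookup ; decode = tabulate ∘ decodeFun (finite-Fin n) finX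
  ; decode-encode = λ v → trans (Vec.tabulate-cong (decodeFun-encodeFun (finite-Fin n) finX (lookup v)))
                                (Vec.tabulate∘lookup v) }

finite-Entry : ∀ {A I} k → Finite A → Finite I → Finite (Entry A I k)
finite-Entry k A I = retract
  (λ { (const a) → inj₁ a ; (var σ j) → inj₂ (σ , j) })
  (λ { (inj₁ a) → const a ; (inj₂ (σ , j)) → var σ j })
  (λ { (const a) → refl ; (var σ j) → refl })
  (finite-⊎ A (finite-× I (finite-Fin k)))

module _ {A I : Set} {k n : ℕ} (act : I → A → A) (finA : Finite A) (finI : Finite I) where

  -- `IsParamMap` ranges over functions, but each is pointwise equal to `paramMap` of its
  -- specification, and specifications form a finite type.
  paramMap? : {Q : (Vec A k → Vec A n) → Set} → (∀ {f g} → f ≗ g → Q f → Q g) → Decidable Q →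
              Dec (∃[ f ] (IsParamMap act f × Q f))
  paramMap? {Q} resp Q? = map′
    (λ (spec , inj , q) → paramMap act spec , ((spec , λ _ → refl) , inj) , q)
    (λ (f , ((spec , eq) , inj) , q) →
       spec , (λ {x} {y} e → inj (trans (eq x) (trans e (sym (eq y))))) , resp eq q)
    (exists? (finite-Vec (finite-Entry k finA finI) n) λ spec →
       injective? (paramMap act spec) ×-dec Q? (paramMap act spec))
    where
    finV : ∀ m → Finite (Vec A m)
    finV = finite-Vec finA

    injective? : (f : Vec A k → Vec A n) → Dec (Injective _≡_ _≡_ f)
    injective? f = map′ (λ h {x} {y} → h x y) (λ h x y → h)
      (forall? (finV k) λ x → forall? (finV k) λ y →
         (Finite._≟_ (finV n) (f x) (f y)) →-dec (Finite._≟_ (finV k) x y))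

TTTProp? : ∀ t k d → Decidable (TTTProp t k d)
TTTProp? t k d n = forallFun? (finite-Vec finT n) (finite-Fin k)
  (λ f≗g (f , isP , col , mono) → f , isP , col , λ x → trans (sym (f≗g (f x))) (mono x))
  (λ c → paramMap? tttAct finT finite-Bool
     (λ f≗g (col , mono) → col , λ x → trans (cong c (sym (f≗g x))) (mono x))
     (λ f → exists? (finite-Fin k) λ col → forall? (finite-Vec finT d) λ x → c (f x) Fin.≟ col))
  where
  finT : Finite (Fin t)
  finT = finite-Fin t

-- Symmetry of a given colour function is decidable, so the search runs over all functions on pairs,
-- with symmetry as a premise.
GrProp? : Decidable GrProp
GrProp? n = map′ (λ h (c , s) → h (uncurry c) s) (λ h c s → h (curry c , s))
  (forallFun? (finite-× (finB n) (finB n)) (finite-Fin 2)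
    (λ f≗g h s → let (f , isP , col , mono) = h (λ u v → trans (f≗g _) (trans (s u v) (sym (f≗g _))))
                 in f , isP , col , λ x y x≢y → trans (sym (f≗g _)) (mono x y x≢y))
    (λ c → (forall? (finB n) λ u → forall? (finB n) λ v → c (u , v) Fin.≟ c (v , u))
       →-dec
       paramMap? grAct finite-Bool finite-Bool
         (λ f≗g (col , mono) → col , λ x y x≢y → trans (cong₂ (curry c) (sym (f≗g x)) (sym (f≗g y))) (mono x y x≢y))
         (λ f → exists? (finite-Fin 2) λ col → forall? (finB 2) λ x → forall? (finB 2) λ y →
            ¬? (Finite._≟_ (finB 2) x y) →-dec (c (f x , f y) Fin.≟ col))))
  where
  finB : ∀ m → Finite (Vec Bool m)
  finB = finite-Vec finite-Bool

least : ∀ {P : ℕ → Set} → Decidable P → ∀ n → P n → ∃[ m ] (IsLeast P m × m ≤ n)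
least {P} P? n p with P? 0
... | yes p₀ = 0 , (p₀ , λ _ _ → z≤n) , z≤n
least P? zero p    | no ¬p₀ = ⊥-elim (¬p₀ p)
least P? (suc n) p | no ¬p₀ with least (P? ∘ suc) n p
... | m , (pₘ , min) , m≤n = suc m , (pₘ , λ { zero q → ⊥-elim (¬p₀ q) ; (suc l) q → s≤s (min l q) }) , s≤s m≤n

-- The Hales–Jewett theorem

any-++ˡ : ∀ {X : Set} {P : X → Set} {m n} {v : Vec X m} {w : Vec X n} → Any P v → Any P (v ++ w)
any-++ˡ (here p)  = here p
any-++ˡ (there p) = there (any-++ˡ p)

any-++ʳ : ∀ {X : Set} {P : X → Set} {m n} (v : Vec X m) {w : Vec X n} → Any P w → Any P (v ++ w)
any-++ʳ []      p = p
any-++ʳ (_ ∷ v) p = there (any-++ʳ v p)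

-- The variable of a combinatorial line is encoded as nothing.
Template : Set → ℕ → Set
Template A n = Vec (Maybe A) n

point : ∀ {A n} → Template A n → A → Vec A n
point L a = map (fromMaybe a) L

Active : ∀ {A n} → Template A n → Set
Active = Any (_≡ nothing)

constant : ∀ {A n} → Vec A n → Template A n
constant = map just

point-++ : ∀ {A m n} (L : Template A m) (M : Template A n) a → point (L ++ M) a ≡ point L a ++ point M a
point-++ L M a = Vec.map-++ (fromMaybe a) L M

point-constant : ∀ {A n} (v : Vec A n) a → point (constant v) a ≡ v
point-constant v a = trans (sym (Vec.map-∘ (fromMaybe a) just v)) (Vec.map-id v)

MonoLine : ∀ {A C : Set} {n} → (Vec A n → C) → Set
MonoLine {A} {n = n} c = ∃[ L ] (Active {A} {n} L × ∀ a b → c (point L a) ≡ c (point L b))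

lift : ∀ {t n} → Template (Fin t) n → Template (Fin (suc t)) n
lift = map (Maybe.map suc)

point-lift : ∀ {t n} (L : Template (Fin t) n) a → point (lift L) (suc a) ≡ map suc (point L a)
point-lift []             a = refl
point-lift (just _ ∷ L)   a = cong (_ ∷_) (point-lift L a)
point-lift (nothing ∷ L)  a = cong (_ ∷_) (point-lift L a)

active-lift : ∀ {t n} {L : Template (Fin t) n} → Active L → Active (lift L)
active-lift (here refl) = here refl
active-lift (there p)   = there (active-lift p)

-- r lines through a common point (at the letter zero), each monochromatic away from it,
-- in pairwise distinct colours.
record Focused {t n : ℕ} {C : Set} (r : ℕ) (c : Vec (Fin (suc t)) n → C) : Set where
  field
    focus      : Vec (Fin (suc t)) n
    line       : Fin r → Template (Fin (suc t)) n
    active     : ∀ i → Active (line i)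
    focused    : ∀ i → point (line i) zero ≡ focus
    colour     : Fin r → C
    coloured   : ∀ i a → c (point (line i) (suc a)) ≡ colour i
    distinct   : Injective _≡_ _≡_ colour

HalesJewett : ℕ → Set
HalesJewett t = ∀ k → ∃[ n ] ∀ (c : Vec (Fin t) n → Fin k) → MonoLine c

module _ {t : ℕ} (hj : HalesJewett (suc t)) (k : ℕ) where

  -- Colour focusing. The prefix length `m` is chosen after `n`, because a prefix is coloured by the
  -- whole colouring that it induces on suffixes, of which there are finitely many. On a line
  -- monochromatic in this sense, all points away from the letter `zero` are interchangeable in
  -- front of any suffix.
  focusing : ∀ r → ∃[ n ] ∀ (c : Vec (Fin (suc (suc t))) n → Fin k) → MonoLine c ⊎ Focused r c
  focusing zero = 0 , λ c → inj₂ record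
    { focus = [] ; line = λ () ; active = λ () ; focused = λ () ; colour = λ ()
    ; coloured = λ () ; distinct = λ { {()} } }
  focusing (suc r) with focusing r
  ... | n , find = m + n , extend
    where
    A : Set
    A = Fin (suc (suc t))

    finV : Finite (Vec A n)
    finV = finite-Vec (finite-Fin _) n

    m : ℕ
    m = proj₁ (hj (k ^ Finite.size finV))

    extend : (c : Vec A (m + n) → Fin k) → MonoLine c ⊎ Focused (suc r) c
    -- Words over the smaller alphabet enter through `map suc`, which keeps the letter `zero` free
    -- for the focus.
    extend c with proj₂ (hj (k ^ Finite.size finV))
                    (λ w → encodeFun finV (finite-Fin k) (λ v → c (map suc w ++ v)))
    ... | L , actL , monoL = extend′ (find c′)
      where
      a₀ : Vec A m
      a₀ = map suc (point L zero)

      c′ : Vec A n → Fin k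
      c′ v = c (a₀ ++ v)

      same : ∀ a v → c (point (lift L) (suc a) ++ v) ≡ c′ v
      same a v = trans (cong (λ w → c (w ++ v)) (point-lift L a))
                       (encodeFun-injective finV (finite-Fin k) (monoL a zero) v)

      prefixed : MonoLine c′ → MonoLine c
      prefixed (M , actM , monoM) =
        constant a₀ ++ M , any-++ʳ (constant a₀) actM , λ a b →
          trans (cong c (eq a)) (trans (monoM a b) (sym (cong c (eq b))))
        where
        eq : ∀ a → point (constant a₀ ++ M) a ≡ a₀ ++ point M a
        eq a = trans (point-++ (constant a₀) M a) (cong (_++ point M a) (point-constant a₀ a))

      extend′ : MonoLine c′ ⊎ Focused r c′ → MonoLine c ⊎ Focused (suc r) c
      extend′ (inj₁ mono) = inj₁ (prefixed mono)
      -- If the focus has the colour of one of the lines, that line is monochromatic at `zero` too;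
      -- otherwise the focus supplies a new colour.
      extend′ (inj₂ F) with Fin.any? (λ i → c′ (Focused.focus F) Fin.≟ Focused.colour F i)
      ... | yes (i , eq) = inj₁ (prefixed (line i , active i , λ a b → trans (col a) (sym (col b))))
        where
        open Focused F
        col : ∀ a → c′ (point (line i) a) ≡ colour i
        col zero    = trans (cong c′ (focused i)) eq
        col (suc a) = coloured i a
      ... | no ¬eq = inj₂ record
        { focus = point (lift L) zero ++ focus
        ; line = line⁺
        ; active = λ { zero → any-++ˡ (active-lift actL) ; (suc i) → any-++ˡ (active-lift actL) }
        ; focused = λ { zero    → trans (point-++ (lift L) (constant focus) zero)
                                        (cong (point (lift L) zero ++_) (point-constant focus zero))
                      ; (suc i) → trans (point-++ (lift L) (line i) zero)
                                        (cong (point (lift L) zero ++_) (focused i)) }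
        ; colour = colour⁺
        ; coloured = λ
            { zero a    → trans (cong c (point-++ (lift L) (constant focus) (suc a)))
                            (trans (same a _) (cong c′ (point-constant focus (suc a))))
            ; (suc i) a → trans (cong c (point-++ (lift L) (line i) (suc a)))
                            (trans (same a _) (coloured i a)) }
        ; distinct = λ
            { {zero}  {zero}  _ → refl
            ; {zero}  {suc j} e → ⊥-elim (¬eq (j , e))
            ; {suc i} {zero}  e → ⊥-elim (¬eq (i , sym e))
            ; {suc i} {suc j} e → cong suc (distinct e) }
        }
        where
        open Focused F
        line⁺ : Fin (suc r) → Template A (m + n)
        -- The new line moves in the prefix only and takes the colour of the old focus; the old
        -- lines now move in both parts and keep their colours.
        line⁺ zero    = lift L ++ constant focus
        line⁺ (suc i) = lift L ++ line i

        colour⁺ : Fin (suc r) → Fin k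
        colour⁺ zero    = c′ focus
        colour⁺ (suc i) = colour i

  -- With one more focused line than there are colours, two of the distinct colours would coincide,
  -- so only the monochromatic line remains.
  halesJewett-suc : ∃[ n ] ∀ (c : Vec (Fin (suc (suc t))) n → Fin k) → MonoLine c
  halesJewett-suc with focusing (suc k)
  ... | n , find = n , λ c → decide c (find c)
    where
    decide : ∀ c → MonoLine c ⊎ Focused (suc k) c → MonoLine c
    decide c (inj₁ mono) = mono
    decide c (inj₂ F) with Fin.pigeonhole (ℕ.n<1+n k) (Focused.colour F)
    ... | i , j , i<j , eq = ⊥-elim (Fin.<⇒≢ i<j (Focused.distinct F eq))

halesJewett : ∀ t → HalesJewett t
halesJewett zero          k = 1 , λ c → nothing ∷ [] , here refl , λ ()
halesJewett (suc zero)    k = 1 , λ c → nothing ∷ [] , here refl , λ { zero zero → refl }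
halesJewett (suc (suc t)) k = halesJewett-suc (halesJewett (suc t)) k

-- Tic-tac-toe spaces from lines over blocks

module _ {t d : ℕ} where
  private
    finB : Finite (Vec (Fin t) d)
    finB = finite-Vec (finite-Fin t) d

    open Finite finB using (encode; decode; decode-encode) renaming (size to letters)

    block : Maybe (Fin letters) → Vec (Entry (Fin t) Bool d) d
    block nothing  = tabulate (var false)
    block (just b) = map const (decode b)

    evalBlock : Vec (Fin t) d → Vec (Entry (Fin t) Bool d) d → Vec (Fin t) d
    evalBlock x = map (λ e → evalEntry tttAct e x)

    evalBlock-block : ∀ x e → evalBlock x (block e) ≡ decode (fromMaybe (encode x) e)
    evalBlock-block x (just b) = trans (sym (Vec.map-∘ _ const (decode b))) (Vec.map-id _)
    evalBlock-block x nothing  = trans (sym (Vec.tabulate-∘ _ (var false)))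
                                   (trans (Vec.tabulate∘lookup x) (sym (decode-encode x)))

    spec : ∀ {m} → Template (Fin letters) m → Vec (Entry (Fin t) Bool d) (m * d)
    spec L = concat (map block L)

    paramMap-spec : ∀ {m} (L : Template (Fin letters) m) x →
                    paramMap tttAct (spec L) x ≡ concat (map decode (point L (encode x)))
    paramMap-spec [] x = refl
    paramMap-spec (e ∷ L) x = trans (Vec.map-++ _ (block e) (spec L))
      (cong₂ _++_ (evalBlock-block x e) (paramMap-spec L x))

    -- An active block shows the argument itself, unreflected and in order, so the argument can be
    -- read off.
    concat-injective : ∀ {m} {L : Template (Fin letters) m} → Active L → ∀ x y →
      concat (map decode (point L (encode x))) ≡ concat (map decode (point L (encode y))) → x ≡ y
    concat-injective (here refl) x y eq =
      trans (sym (decode-encode x)) (trans (Vec.++-injectiveˡ _ _ eq) (decode-encode y))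
    concat-injective {L = e ∷ L} (there p) x y eq =
      concat-injective p x y
        (Vec.++-injectiveʳ (decode (fromMaybe (encode x) e)) (decode (fromMaybe (encode y) e)) eq)

  -- A line over the alphabet [t]^d is a d-dimensional space over [t].
  tttProp : ∀ k x₀ → ∃[ n ] TTTProp t k d n
  tttProp k x₀ with halesJewett letters k
  ... | m , hj = m * d , λ c → space c (hj (c ∘ concat ∘ map decode))
    where
    space : ∀ c → MonoLine (c ∘ concat ∘ map decode) → _
    space c (L , act , mono) =
      paramMap tttAct (spec L) ,
      ((spec L , λ _ → refl) , λ {x} {y} eq → concat-injective act x y
         (trans (sym (paramMap-spec L x)) (trans eq (paramMap-spec L y)))) ,
      c (paramMap tttAct (spec L) x₀) ,
      λ x → trans (cong c (paramMap-spec L x))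
              (trans (mono (encode x) (encode x₀)) (sym (cong c (paramMap-spec L x₀))))

-- Ramsey's theorem for pairs and monochromatic planes of directions

-- Thin m n is the set of order-preserving injections from Fin m to Fin n, i.e. of m-subsets of Fin n.
data Thin : ℕ → ℕ → Set where
  done : Thin 0 0
  keep : ∀ {m n} → Thin m n → Thin (suc m) (suc n)
  skip : ∀ {m n} → Thin m n → Thin m (suc n)

none : ∀ {n} → Thin 0 n
none {zero}  = done
none {suc n} = skip none

none-unique : ∀ {n} (τ : Thin 0 n) → τ ≡ none
none-unique done     = refl
none-unique (skip τ) = cong skip (none-unique τ)

infixr 9 _⊙_
_⊙_ : ∀ {l m n} → Thin m n → Thin l m → Thin l n
done   ⊙ done   = done
keep θ ⊙ keep τ = keep (θ ⊙ τ)
keep θ ⊙ skip τ = skip (θ ⊙ τ)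
skip θ ⊙ τ      = skip (θ ⊙ τ)

⊙-assoc : ∀ {k l m n} (θ : Thin m n) (ψ : Thin l m) (τ : Thin k l) → (θ ⊙ ψ) ⊙ τ ≡ θ ⊙ (ψ ⊙ τ)
⊙-assoc done     done     done     = refl
⊙-assoc (keep θ) (keep ψ) (keep τ) = cong keep (⊙-assoc θ ψ τ)
⊙-assoc (keep θ) (keep ψ) (skip τ) = cong skip (⊙-assoc θ ψ τ)
⊙-assoc (keep θ) (skip ψ) τ        = cong skip (⊙-assoc θ ψ τ)
⊙-assoc (skip θ) ψ        τ        = cong skip (⊙-assoc θ ψ τ)

thinnings : ∀ m n → List (Thin m n)
thinnings zero    n       = none ∷ []
thinnings (suc m) zero    = []
thinnings (suc m) (suc n) = List.map keep (thinnings m n) List.++ List.map skip (thinnings (suc m) n)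

pad : ∀ {A : Set} → A → ∀ {m n} → Thin m n → Vec A m → Vec A n
pad z done     v       = v
pad z (keep θ) (x ∷ v) = x ∷ pad z θ v
pad z (skip θ) v       = z ∷ pad z θ v

pad-⊙ : ∀ {A : Set} (z : A) {l m n} (θ : Thin m n) (τ : Thin l m) v → pad z (θ ⊙ τ) v ≡ pad z θ (pad z τ v)
pad-⊙ z done     done     v       = refl
pad-⊙ z (keep θ) (keep τ) (x ∷ v) = cong (x ∷_) (pad-⊙ z θ τ v)
pad-⊙ z (keep θ) (skip τ) v       = cong (z ∷_) (pad-⊙ z θ τ v)
pad-⊙ z (skip θ) τ        v       = cong (z ∷_) (pad-⊙ z θ τ v)

map-pad : ∀ {A B : Set} (f : A → B) z {m n} (θ : Thin m n) v → map f (pad z θ v) ≡ pad (f z) θ (map f v)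
map-pad f z done     []      = refl
map-pad f z (keep θ) (x ∷ v) = cong (f x ∷_) (map-pad f z θ v)
map-pad f z (skip θ) v       = cong (f z ∷_) (map-pad f z θ v)

any-pad : ∀ {A : Set} {P : A → Set} z {m n} (θ : Thin m n) {v} → Any P v → Any P (pad z θ v)
any-pad z (keep θ) (here p)  = here p
any-pad z (keep θ) (there p) = there (any-pad z θ p)
any-pad z (skip θ) p         = there (any-pad z θ p)

Homogeneous : ∀ {r n} → (Thin r n → Bool) → Bool → ℕ → Set
Homogeneous {r} {n} c b m = ∃[ θ ] (∀ (τ : Thin r m) → c (θ ⊙ τ) ≡ b)

homogeneous-skip : ∀ {r n m b} (c : Thin r (suc n) → Bool) → Homogeneous (c ∘ skip) b m → Homogeneous c b m
homogeneous-skip c (θ , mono) = skip θ , mono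

homogeneous-keep₁ : ∀ {n m b} (c : Thin 1 (suc n) → Bool) → c (keep none) ≡ b →
                    Homogeneous (c ∘ skip) b m → Homogeneous c b (suc m)
homogeneous-keep₁ c eq (θ , mono) = keep θ , λ
  { (keep τ) → trans (cong (c ∘ keep) (none-unique (θ ⊙ τ))) eq ; (skip τ) → mono τ }

pigeonhole : ∀ {n} a b (c : Thin 1 n → Bool) → a + b ≤ n → Homogeneous c false a ⊎ Homogeneous c true b
pigeonhole zero    b       c _ = inj₁ (none , λ ())
pigeonhole (suc a) zero    c _ = inj₂ (none , λ ())
pigeonhole {suc n} (suc a) (suc b) c (s≤s le) with c (keep none) in eq
... | false with pigeonhole a (suc b) (c ∘ skip) le
...   | inj₁ h = inj₁ (homogeneous-keep₁ c eq h)
...   | inj₂ h = inj₂ (homogeneous-skip c h)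
pigeonhole {suc n} (suc a) (suc b) c (s≤s le) | true
  with pigeonhole (suc a) b (c ∘ skip) (subst (_≤ n) (ℕ.+-suc a b) le)
...   | inj₁ h = inj₁ (homogeneous-skip c h)
...   | inj₂ h = inj₂ (homogeneous-keep₁ c eq h)

-- Equal to 2 ^ s - 1: one chosen point, and a pigeonhole that splits the others by the colour of
-- their pair with it.
ramseyBound : ℕ → ℕ
ramseyBound zero    = 0
ramseyBound (suc s) = suc (ramseyBound s + ramseyBound s)

ramseyBound< : ∀ s → ramseyBound s < 2 ^ s
ramseyBound< zero    = s≤s z≤n
ramseyBound< (suc s) = begin
  suc (suc (ramseyBound s + ramseyBound s)) ≡⟨ cong suc (ℕ.+-suc (ramseyBound s) (ramseyBound s)) ⟨
  suc (ramseyBound s) + suc (ramseyBound s) ≤⟨ ℕ.+-mono-≤ (ramseyBound< s) (ramseyBound< s) ⟩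
  2 ^ s + 2 ^ s                             ≡⟨ cong (2 ^ s +_) (ℕ.+-identityʳ (2 ^ s)) ⟨
  2 ^ suc s                                 ∎
  where open ℕ.≤-Reasoning

module _ {n N : ℕ} {b : Bool} (c : Thin 2 (suc n) → Bool) (θ : Thin N n) where

  homogeneous-keep₂ : ∀ {m} → (∀ τ → c (keep (θ ⊙ τ)) ≡ b) →
                      Homogeneous (λ τ → c (skip (θ ⊙ τ))) b m → Homogeneous c b (suc m)
  homogeneous-keep₂ hconst (ψ , mono) = keep (θ ⊙ ψ) , λ
    { (keep τ) → trans (cong (c ∘ keep) (⊙-assoc θ ψ τ)) (hconst (ψ ⊙ τ))
    ; (skip τ) → trans (cong (c ∘ skip) (⊙-assoc θ ψ τ)) (mono τ) }

  homogeneous-skip₂ : ∀ {m} → Homogeneous (λ τ → c (skip (θ ⊙ τ))) b m → Homogeneous c b m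
  homogeneous-skip₂ (ψ , mono) = skip (θ ⊙ ψ) , λ τ → trans (cong (c ∘ skip) (⊙-assoc θ ψ τ)) (mono τ)

-- The pairs through the first point colour the remaining points. The recursion runs inside a large
-- colour class `θ` of that colouring; its result is either already as wanted or grows by the first
-- point. Each step lowers `a + b` by one and about halves the available points.
ramsey : ∀ {n} a b (c : Thin 2 n → Bool) → ramseyBound (a + b) ≤ n → Homogeneous c false a ⊎ Homogeneous c true b
ramsey zero    b       c _ = inj₁ (none , λ ())
ramsey (suc a) zero    c _ = inj₂ (none , λ ())
ramsey {suc n} (suc a) (suc b) c (s≤s le)
  with pigeonhole (ramseyBound (a + suc b)) (ramseyBound (a + suc b)) (c ∘ keep) le
... | inj₁ (θ , hconst) with ramsey a (suc b) (λ τ → c (skip (θ ⊙ τ))) ℕ.≤-refl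
...   | inj₁ h = inj₁ (homogeneous-keep₂ c θ hconst h)
...   | inj₂ h = inj₂ (homogeneous-skip₂ c θ h)
ramsey {suc n} (suc a) (suc b) c (s≤s le) | inj₂ (θ , hconst)
  with ramsey (suc a) b (λ τ → c (skip (θ ⊙ τ))) (ℕ.≤-reflexive (cong ramseyBound (sym (ℕ.+-suc a b))))
...   | inj₁ h = inj₁ (homogeneous-skip₂ c θ h)
...   | inj₂ h = inj₂ (homogeneous-keep₂ c θ hconst h)

n<2^n : ∀ n → n < 2 ^ n
n<2^n n = ℕ.≤-trans (s≤s (n≤bound n)) (ramseyBound< n)
  where
  n≤bound : ∀ n → n ≤ ramseyBound n
  n≤bound zero    = z≤n
  n≤bound (suc n) = s≤s (ℕ.≤-trans (n≤bound n) (ℕ.m≤m+n _ _))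

n+n≤2^n : ∀ n → n + n ≤ 2 ^ n
n+n≤2^n zero    = z≤n
n+n≤2^n (suc n) = ℕ.≤-trans (ℕ.+-mono-≤ (n<2^n n) (n<2^n n))
                            (ℕ.≤-reflexive (cong (2 ^ n +_) (sym (ℕ.+-identityʳ (2 ^ n)))))

↑↑-mono-≤ : ∀ {a b} → a ≤ b → 2 ↑↑ a ≤ 2 ↑↑ b
↑↑-mono-≤ {b = zero}  z≤n     = ℕ.≤-refl
↑↑-mono-≤ {b = suc b} z≤n     = ℕ.m^n>0 2 (2 ↑↑ b)
↑↑-mono-≤             (s≤s h) = ℕ.^-monoʳ-≤ 2 (↑↑-mono-≤ h)

-- The bound is exponential in `m + m`, and the doubling is absorbed by one further exponential;
-- each application therefore costs two levels of the tower.
ramsey-↑↑ : ∀ b {m n} → m ≤ 2 ↑↑ b → 2 ↑↑ (2 + b) ≤ n → (c : Thin 2 n → Bool) → ∃[ col ] Homogeneous c col m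
ramsey-↑↑ b {m} {n} m≤ ≤n c with ramsey m m c (begin
    ramseyBound (m + m)       ≤⟨ ℕ.<⇒≤ (ramseyBound< (m + m)) ⟩
    2 ^ (m + m)               ≤⟨ ℕ.^-monoʳ-≤ 2 (ℕ.+-mono-≤ m≤ m≤) ⟩
    2 ^ (2 ↑↑ b + 2 ↑↑ b)     ≤⟨ ℕ.^-monoʳ-≤ 2 (n+n≤2^n (2 ↑↑ b)) ⟩
    2 ↑↑ (2 + b)              ≤⟨ ≤n ⟩
    n                         ∎)
  where open ℕ.≤-Reasoning
... | inj₁ h = false , h
... | inj₂ h = true , h

-- Restriction preserves homogeneity already achieved, so the colourings are treated in turn, and
-- the height falls from `6 + b` through `4 + b` and `2 + b` to `b`.
ramsey³ : ∀ b {m n} → m ≤ 2 ↑↑ b → 2 ↑↑ (6 + b) ≤ n → (c₁ c₂ c₃ : Thin 2 n → Bool) →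
          ∃[ θ ] (∃[ b₁ ] ∃[ b₂ ] ∃[ b₃ ] ∀ (τ : Thin 2 m) → c₁ (θ ⊙ τ) ≡ b₁ × c₂ (θ ⊙ τ) ≡ b₂ × c₃ (θ ⊙ τ) ≡ b₃)
ramsey³ b m≤ ≤n c₁ c₂ c₃
  with ramsey-↑↑ (4 + b) ℕ.≤-refl ≤n c₁
... | b₁ , θ₁ , h₁ with ramsey-↑↑ (2 + b) ℕ.≤-refl ℕ.≤-refl (c₂ ∘ (θ₁ ⊙_))
... | b₂ , θ₂ , h₂ with ramsey-↑↑ b m≤ ℕ.≤-refl (c₃ ∘ (θ₁ ⊙_) ∘ (θ₂ ⊙_))
... | b₃ , θ₃ , h₃ = θ₁ ⊙ θ₂ ⊙ θ₃ , b₁ , b₂ , b₃ , λ τ →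
  trans (cong c₁ (⊙-assoc θ₁ (θ₂ ⊙ θ₃) τ)) (h₁ ((θ₂ ⊙ θ₃) ⊙ τ)) ,
  trans (cong c₂ (eq τ)) (h₂ (θ₃ ⊙ τ)) ,
  trans (cong c₃ (eq τ)) (h₃ τ)
  where
  eq : ∀ τ → (θ₁ ⊙ θ₂ ⊙ θ₃) ⊙ τ ≡ θ₁ ⊙ θ₂ ⊙ θ₃ ⊙ τ
  eq τ = trans (⊙-assoc θ₁ (θ₂ ⊙ θ₃) τ) (cong (θ₁ ⊙_) (⊙-assoc θ₂ θ₃ τ))

-- Directions of edges and the planes they span

Direction : ℕ → Set
Direction = Vec (Maybe Bool)

pattern ⊕ = just false
pattern ⊖ = just true
pattern ○ = nothing

-- A plane is spanned by two directions with disjoint supports, its generators; a cell records which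
-- of them, if any, moves that coordinate, and with which sign.
Plane : ℕ → Set
Plane = Vec (Maybe (Fin 2 × Bool))

Moves : Fin 2 → Maybe (Fin 2 × Bool) → Set
Moves j nothing        = ⊥
Moves j (just (i , _)) = i ≡ j

moves? : ∀ j x → Dec (Moves j x)
moves? j nothing        = no λ ()
moves? j (just (i , _)) = i Fin.≟ j

Proper : ∀ {n} → Plane n → Set
Proper γ = Any (Moves zero) γ × Any (Moves (suc zero)) γ

proper? : ∀ {n} (γ : Plane n) → Dec (Proper γ)
proper? γ = any? (moves? zero) γ ×-dec any? (moves? (suc zero)) γ

Coefficients : Set
Coefficients = Maybe Bool × Maybe Bool

scale : Coefficients → Maybe (Fin 2 × Bool) → Maybe Bool
scale s       nothing               = nothing
scale (x , y) (just (zero     , σ)) = Maybe.map (σ xor_) x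
scale (x , y) (just (suc zero , σ)) = Maybe.map (σ xor_) y

infixl 7 _·_
_·_ : ∀ {n} → Plane n → Coefficients → Direction n
γ · s = map (scale s) γ

-- The two sides and the two diagonals of a square; the negated combinations describe the same edges
-- with their ends swapped.
coefficients : List Coefficients
coefficients = (⊕ , ○) ∷ (○ , ⊕) ∷ (⊕ , ⊕) ∷ (⊕ , ⊖) ∷ []

MonoPlane : ∀ {n} → (Direction n → Bool) → Set
MonoPlane {n} χ = ∃[ γ ] (Proper {n} γ × ∃[ b ] All (λ s → χ (γ · s) ≡ b) coefficients)

monoPlane-pad : ∀ {m n} (θ : Thin m n) {χ : Direction n → Bool} → MonoPlane (χ ∘ pad nothing θ) → MonoPlane χ
monoPlane-pad θ {χ} (γ , (p , q) , b , mono) =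
  pad nothing θ γ , (any-pad nothing θ p , any-pad nothing θ q) , b ,
  All.map (λ {s} eq → trans (cong χ (map-pad (scale s) nothing θ γ)) eq) mono

-- Refutations as checkable certificates

decodePlane : ∀ n → ℕ → Plane n
decodePlane zero    k = []
decodePlane (suc n) k = cell (k % 5) ∷ decodePlane n (k / 5)
  where
  cell : ℕ → Maybe (Fin 2 × Bool)
  cell 1 = just (zero , false)
  cell 2 = just (zero , true)
  cell 3 = just (suc zero , false)
  cell 4 = just (suc zero , true)
  cell _ = nothing

-- Planes are given by their codes. In k ▸ r the plane k is monochromatic or has a single
-- direction of unknown colour, which is thereby forced; split k branches on the colour of its first generator.
infixr 5 _▸_
data Refutation : Set where
  qed   : Refutation
  _▸_   : ℕ → Refutation → Refutation
  split : ℕ → Refutation → Refutation → Refutation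

module _ {n : ℕ} where

  Partial : Set
  Partial = List (Direction n × Bool)

  colourOf : Partial → Direction n → Maybe Bool
  colourOf []            p = nothing
  colourOf ((q , b) ∷ ψ) p = if ⌊ Vec.≡-dec (Maybe.≡-dec Bool._≟_) p q ⌋ then just b else colourOf ψ p

  isMono : Partial → Plane n → Bool → List Coefficients → Bool
  isMono ψ γ b []       = true
  isMono ψ γ b (s ∷ ss) with colourOf ψ (γ · s)
  ... | nothing = false
  ... | just b′ = ⌊ b′ Bool.≟ b ⌋ ∧ isMono ψ γ b ss

  isClash : Partial → Plane n → Bool
  isClash ψ γ = ⌊ proper? γ ⌋ ∧ (isMono ψ γ true coefficients ∨ isMono ψ γ false coefficients)

  unknown : Partial → Plane n → List Coefficients → Maybe (Direction n)
  unknown ψ γ []       = nothing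
  unknown ψ γ (s ∷ ss) with colourOf ψ (γ · s)
  ... | nothing = just (γ · s)
  ... | just _  = unknown ψ γ ss

  mutual
    check : Partial → Refutation → Bool
    -- A valid refutation is closed by a clash at its last plane, so arriving here means that no
    -- contradiction was found.
    check ψ qed           = false
    check ψ (k ▸ r)       = step ψ (decodePlane n k) r
    check ψ (split k r s) = branch ψ (decodePlane n k · (⊕ , ○)) r s

    step : Partial → Plane n → Refutation → Bool
    step ψ γ r with unknown ψ γ coefficients
    ... | nothing = isClash ψ γ
    ... | just p  = (isClash ((p , true) ∷ ψ) γ ∨ check ((p , true) ∷ ψ) r)
                  ∧ (isClash ((p , false) ∷ ψ) γ ∨ check ((p , false) ∷ ψ) r)

    branch : Partial → Direction n → Refutation → Refutation → Bool
    branch ψ p r s = check ((p , true) ∷ ψ) r ∧ check ((p , false) ∷ ψ) s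

  module _ (χ : Direction n → Bool) where

    Extends : Partial → Set
    Extends = All (λ (p , b) → χ p ≡ b)

    colourOf-sound : ∀ {ψ} → Extends ψ → ∀ p {b} → colourOf ψ p ≡ just b → χ p ≡ b
    colourOf-sound {(q , b) ∷ ψ} (e ∷ es) p eq with Vec.≡-dec (Maybe.≡-dec Bool._≟_) p q
    colourOf-sound {(q , b) ∷ ψ} (e ∷ es) p refl | yes refl = e
    colourOf-sound {(q , b) ∷ ψ} (e ∷ es) p eq   | no _     = colourOf-sound es p eq

    isMono-sound : ∀ {ψ} → Extends ψ → ∀ γ b ss → isMono ψ γ b ss ≡ true → All (λ s → χ (γ · s) ≡ b) ss
    isMono-sound es γ b [] _ = []
    isMono-sound {ψ} es γ b (s ∷ ss) eq with colourOf ψ (γ · s) in known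
    ... | just b′ with b′ Bool.≟ b
    ...   | yes refl = colourOf-sound es (γ · s) known ∷ isMono-sound es γ b ss eq

    isClash-sound : ∀ {ψ} → Extends ψ → ∀ γ → isClash ψ γ ≡ true → MonoPlane χ
    isClash-sound {ψ} es γ eq with proper? γ
    ... | yes proper with isMono ψ γ true coefficients in mono
    ...   | true  = γ , proper , true , isMono-sound es γ true coefficients mono
    ...   | false = γ , proper , false , isMono-sound es γ false coefficients eq

    ∧-true : ∀ a {b} → a ∧ b ≡ true → a ≡ true × b ≡ true
    ∧-true true eq = refl , eq

    mutual
      -- The actual value of `χ` selects the branch at every unknown direction, so the facts in `ψ`
      -- remain true of `χ`; a run that succeeds then ends in a clash, which is a genuine
      -- monochromatic plane.
      check-sound : ∀ {ψ} → Extends ψ → ∀ r → check ψ r ≡ true → MonoPlane χ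
      check-sound es (k ▸ r)       eq = step-sound es (decodePlane n k) r eq
      check-sound {ψ} es (split k r s) eq with χ (decodePlane n k · (⊕ , ○)) in known
      ... | true  = check-sound (known ∷ es) r (proj₁ (∧-true (check ((_ , true) ∷ ψ) r) eq))
      ... | false = check-sound (known ∷ es) s (proj₂ (∧-true (check ((_ , true) ∷ ψ) r) eq))

      step-sound : ∀ {ψ} → Extends ψ → ∀ γ r → step ψ γ r ≡ true → MonoPlane χ
      step-sound {ψ} es γ r eq with unknown ψ γ coefficients
      ... | nothing = isClash-sound es γ eq
      ... | just p with χ p in known
      ...   | true  = clashOrCheck-sound (known ∷ es) γ r (proj₁ (∧-true (isClash ((p , true) ∷ ψ) γ ∨ _) eq))
      ...   | false = clashOrCheck-sound (known ∷ es) γ r (proj₂ (∧-true (isClash ((p , true) ∷ ψ) γ ∨ _) eq))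

      clashOrCheck-sound : ∀ {ψ} → Extends ψ → ∀ γ r → isClash ψ γ ∨ check ψ r ≡ true → MonoPlane χ
      clashOrCheck-sound {ψ} es γ r eq with isClash ψ γ in clash
      ... | true  = isClash-sound es γ clash
      ... | false = check-sound es r eq

pairFacts : ∀ n → Bool → Bool → Bool → List (Direction n × Bool)
pairFacts n b₁ b₂ b₃ = concatMap
  (λ τ → (pad ○ τ (⊕ ∷ ○ ∷ []) , b₁) ∷ (pad ○ τ (⊕ ∷ ⊕ ∷ []) , b₂) ∷ (pad ○ τ (⊕ ∷ ⊖ ∷ []) , b₃) ∷ [])
  (thinnings 2 n)

-- Each refutation, found by computer search, assumes that all unit vectors have the colour true and
-- is named after which of eᵢ + eⱼ and eᵢ - eⱼ (for all i < j) share that colour. The last of the seven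
-- coordinates is not used: it serves as j when eᵢ takes its colour from a pair i < j.
neitherAgrees : Refutation
neitherAgrees =
  split 1381 (split 1506 (1631 ▸ split 1556 (1581 ▸ 1831 ▸ 1681 ▸ 1456 ▸ 1956 ▸ 1366 ▸ split 761
  (3016 ▸ 3041 ▸ 3116 ▸ 836 ▸ 1705 ▸ 2716 ▸ 1655 ▸ 1830 ▸ 1455 ▸ 2991 ▸ 2916 ▸ qed) (2261 ▸ 1141 ▸
  1516 ▸ 2131 ▸ 1591 ▸ 2831 ▸ 1586 ▸ 956 ▸ 1666 ▸ 1291 ▸ 2581 ▸ 1056 ▸ 706 ▸ 1206 ▸ qed)) (1706 ▸
  1456 ▸ 1831 ▸ 1656 ▸ 2581 ▸ 1341 ▸ 2541 ▸ split 806 (1056 ▸ 2931 ▸ 1931 ▸ 1956 ▸ 1366 ▸ 706 ▸ 1991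
  ▸ 1911 ▸ 1081 ▸ 2241 ▸ 2031 ▸ 1661 ▸ 416 ▸ 2911 ▸ 2161 ▸ qed) (2306 ▸ 1931 ▸ 1956 ▸ 2566 ▸ 706 ▸
  1936 ▸ 691 ▸ 1206 ▸ 1066 ▸ 2156 ▸ 1061 ▸ 341 ▸ 2311 ▸ 2186 ▸ qed))) (1766 ▸ 2256 ▸ 2766 ▸ 1391 ▸
  2006 ▸ 2891 ▸ split 1431 (1456 ▸ 1466 ▸ 2916 ▸ 1461 ▸ 961 ▸ 2991 ▸ 2961 ▸ 2930 ▸ 2955 ▸ 2905 ▸ 955
  ▸ 2466 ▸ 2416 ▸ qed) (2081 ▸ 1491 ▸ 2941 ▸ 831 ▸ 1461 ▸ 961 ▸ 1116 ▸ 2706 ▸ 2031 ▸ 416 ▸ 216 ▸ 491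
  ▸ 241 ▸ 211 ▸ 2036 ▸ 2086 ▸ qed))) (2641 ▸ 1641 ▸ 2881 ▸ split 1386 (2011 ▸ 2391 ▸ 1636 ▸ split
  1411 (1461 ▸ 2441 ▸ 2086 ▸ 956 ▸ 836 ▸ 2036 ▸ 1216 ▸ 541 ▸ 591 ▸ 566 ▸ 331 ▸ 2181 ▸ 2206 ▸ qed)
  (1711 ▸ 2416 ▸ 2711 ▸ 1586 ▸ 956 ▸ 836 ▸ 2286 ▸ 1836 ▸ 1686 ▸ 1961 ▸ 1941 ▸ 1911 ▸ 1916 ▸ 1031 ▸
  706 ▸ 1081 ▸ qed)) (2016 ▸ 2886 ▸ 1006 ▸ 2266 ▸ 891 ▸ 2136 ▸ split 1536 (1586 ▸ 2211 ▸ 2316 ▸ 961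
  ▸ 831 ▸ 966 ▸ 1081 ▸ 956 ▸ qed) (2291 ▸ 2836 ▸ 831 ▸ 961 ▸ 1206 ▸ 991 ▸ 956 ▸ qed)))

differenceAgrees : Refutation
differenceAgrees =
  split 3900 (split 3876 (split 3256 (split 3156 (split 3756 (split 780 (split 756 (split 3776
  (split 3780 (split 156 (split 3280 (split 656 (split 3276 (split 4031 (4291 ▸ 6031 ▸ 13531 ▸ 4331
  ▸ 11591 ▸ split 3880 (split 776 (split 7661 (split 7681 (7741 ▸ split 4061 (15461 ▸ 15441 ▸ split
  7656 (7706 ▸ 15466 ▸ 7666 ▸ split 7625 (8250 ▸ 15406 ▸ 10750 ▸ 14781 ▸ 12281 ▸ 5281 ▸ 14156 ▸
  10281 ▸ 11031 ▸ 10906 ▸ 7906 ▸ 8406 ▸ 2281 ▸ 11281 ▸ 9781 ▸ 831 ▸ 3831 ▸ 5031 ▸ 11341 ▸ 10031 ▸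
  9841 ▸ 3081 ▸ 15081 ▸ 7591 ▸ 6591 ▸ 2150 ▸ 8150 ▸ 10626 ▸ 9626 ▸ 2456 ▸ 14456 ▸ 4466 ▸ 3466 ▸
  10806 ▸ 4441 ▸ 5311 ▸ 4816 ▸ qed) (15401 ▸ 15381 ▸ 15405 ▸ 4041 ▸ 4151 ▸ 4131 ▸ 4081 ▸ 4155 ▸
  11841 ▸ 11401 ▸ 11381 ▸ split 3131 (3206 ▸ 6006 ▸ 5431 ▸ 11241 ▸ 10616 ▸ 12491 ▸ 5455 ▸ 5456 ▸
  split 7061 (7086 ▸ 12016 ▸ 10630 ▸ 7955 ▸ 11580 ▸ 11586 ▸ 11461 ▸ 386 ▸ qed) (10211 ▸ 8561 ▸ 766 ▸
  9466 ▸ 10216 ▸ qed)) (6081 ▸ 5381 ▸ 1650 ▸ 6206 ▸ 4706 ▸ 10941 ▸ 2326 ▸ 5451 ▸ 5456 ▸ 10926 ▸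
  11456 ▸ 4156 ▸ 11416 ▸ 7951 ▸ 11331 ▸ 11291 ▸ 7616 ▸ qed))) (7716 ▸ 15416 ▸ 15456 ▸ 7691 ▸ 11841 ▸
  4041 ▸ 4066 ▸ split 7781 (15341 ▸ 8041 ▸ 15216 ▸ 7916 ▸ 15591 ▸ 7791 ▸ 11530 ▸ 11526 ▸ 4341 ▸ 576
  ▸ 4201 ▸ 11426 ▸ 3951 ▸ qed) (15541 ▸ 15581 ▸ 7841 ▸ 11630 ▸ split 7786 (15586 ▸ 7866 ▸ 11686 ▸
  11681 ▸ 66 ▸ qed) (11661 ▸ 116 ▸ 86 ▸ 11681 ▸ 11686 ▸ 15566 ▸ qed)))) (6091 ▸ 13591 ▸ 11561 ▸ 2030
  ▸ split 7656 (9216 ▸ 14216 ▸ 7341 ▸ 4841 ▸ 14376 ▸ qed) (7966 ▸ 10626 ▸ 8126 ▸ 4841 ▸ 7341 ▸ 14686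
  ▸ qed))) (8331 ▸ 10831 ▸ 11431 ▸ 9506 ▸ split 4556 (13956 ▸ 14556 ▸ 15206 ▸ 12081 ▸ 10650 ▸ qed)
  (14581 ▸ 8150 ▸ 14400 ▸ 15206 ▸ 12081 ▸ 8956 ▸ qed))) (11411 ▸ 8291 ▸ 10791 ▸ 166 ▸ split 7036
  (8916 ▸ 14536 ▸ 15166 ▸ 14541 ▸ 8130 ▸ qed) (12041 ▸ 14380 ▸ 10630 ▸ 14541 ▸ 15166 ▸ 13916 ▸
  qed))) (1076 ▸ 2076 ▸ 2926 ▸ qed)) (10380 ▸ 11380 ▸ 9130 ▸ qed)) (split 4531 (11091 ▸ 14531 ▸ 5791
  ▸ 5831 ▸ split 7781 (split 4661 (14041 ▸ 2276 ▸ split 3880 (split 6526 (9041 ▸ 10411 ▸ 8461 ▸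
  10491 ▸ 666 ▸ 9766 ▸ 10416 ▸ 5156 ▸ 9791 ▸ 9866 ▸ 6541 ▸ 6586 ▸ 13081 ▸ 6591 ▸ 13086 ▸ 6616 ▸ 9811
  ▸ 9806 ▸ 66 ▸ qed) (split 4061 (15341 ▸ split 286 (14661 ▸ 10411 ▸ 8461 ▸ 10491 ▸ 666 ▸ 9766 ▸
  10416 ▸ 5156 ▸ 9791 ▸ 9866 ▸ 9661 ▸ 6586 ▸ 3616 ▸ 9711 ▸ 6741 ▸ 12836 ▸ 6691 ▸ 3566 ▸ 9426 ▸ qed)
  (split 7786 (7791 ▸ 10911 ▸ split 1276 (11041 ▸ 2576 ▸ 1326 ▸ 10441 ▸ 11066 ▸ 10311 ▸ 1066 ▸ 831 ▸
  2291 ▸ 2316 ▸ 1691 ▸ 2056 ▸ 10806 ▸ 11431 ▸ qed) (11026 ▸ 1666 ▸ 4541 ▸ 10781 ▸ 15216 ▸ 4186 ▸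
  split 151 (166 ▸ 2666 ▸ 11411 ▸ 2286 ▸ 7911 ▸ 86 ▸ 10666 ▸ 11311 ▸ 10716 ▸ 5031 ▸ 4781 ▸ 10091 ▸
  10966 ▸ 8186 ▸ 2126 ▸ 8561 ▸ 10341 ▸ 7311 ▸ qed) (14541 ▸ 15166 ▸ 8130 ▸ qed))) (10916 ▸ 8416 ▸
  11536 ▸ 4666 ▸ 13416 ▸ 10291 ▸ 10286 ▸ 7166 ▸ split 7656 (10781 ▸ 2916 ▸ 2880 ▸ 6041 ▸ 5541 ▸ 5401
  ▸ 4541 ▸ 10151 ▸ 12276 ▸ 14776 ▸ 14500 ▸ qed) (7916 ▸ 8041 ▸ 11411 ▸ 11791 ▸ 166 ▸ 4130 ▸ 15166 ▸
  11541 ▸ 15291 ▸ qed)))) (4191 ▸ 4091 ▸ 4211 ▸ 3826 ▸ split 4036 (4116 ▸ 4336 ▸ 4366 ▸ 4341 ▸ 330 ▸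
  qed) (4241 ▸ 430 ▸ 580 ▸ 4366 ▸ 4341 ▸ 4316 ▸ qed)))) (10380 ▸ 11380 ▸ 9130 ▸ qed)) (14791 ▸ 5491
  ▸ 10961 ▸ 830 ▸ split 7786 (8616 ▸ 14086 ▸ 8566 ▸ 5441 ▸ 9426 ▸ qed) (8541 ▸ 12576 ▸ 6326 ▸ 5441 ▸
  8566 ▸ 14816 ▸ qed))) (15541 ▸ 15581 ▸ 7841 ▸ 11650 ▸ split 7786 (15586 ▸ 7866 ▸ 11686 ▸ 11681 ▸
  66 ▸ qed) (11661 ▸ 116 ▸ 86 ▸ 11681 ▸ 11686 ▸ 15566 ▸ qed))) (split 3880 (split 776 (split 7181
  (split 7681 (9181 ▸ split 7056 (7306 ▸ 8306 ▸ split 3781 (3831 ▸ 5031 ▸ 11341 ▸ 10031 ▸ 3791 ▸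
  11956 ▸ 8191 ▸ 13241 ▸ 10650 ▸ 14400 ▸ 6330 ▸ 9430 ▸ 15081 ▸ 14456 ▸ 13216 ▸ 10116 ▸ 13831 ▸ 13211
  ▸ 10706 ▸ 10086 ▸ 8816 ▸ qed) (10081 ▸ split 3281 (9841 ▸ 3291 ▸ 9531 ▸ 3331 ▸ 3531 ▸ 6691 ▸ 12741
  ▸ 9956 ▸ 9426 ▸ 6326 ▸ 9650 ▸ 12900 ▸ 3566 ▸ 6666 ▸ 13081 ▸ 12956 ▸ 12836 ▸ 12831 ▸ 9711 ▸ 9706 ▸
  12866 ▸ qed) (9581 ▸ split 4061 (split 7661 (8741 ▸ 15461 ▸ split 4561 (13961 ▸ 14941 ▸ split 7161
  (14961 ▸ 9161 ▸ split 4661 (14661 ▸ 14866 ▸ split 3905 (4155 ▸ 10155 ▸ 5155 ▸ 3955 ▸ 10580 ▸ 12080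
  ▸ 9650 ▸ 14400 ▸ 13705 ▸ 14580 ▸ 14966 ▸ 12366 ▸ 14956 ▸ qed) (split 7061 (7066 ▸ 8961 ▸ split
  3901 (3951 ▸ 5151 ▸ 10151 ▸ 4151 ▸ 12076 ▸ 10576 ▸ 10650 ▸ 12900 ▸ 15201 ▸ 13576 ▸ 7666 ▸ 4066 ▸
  15456 ▸ qed) (10201 ▸ split 3775 (11456 ▸ split 4681 (11241 ▸ 4941 ▸ 4741 ▸ 14681 ▸ 5941 ▸ split
  7781 (9041 ▸ 14041 ▸ 8041 ▸ split 3755 (split 6301 (9426 ▸ 6326 ▸ split 3926 (13326 ▸ 8526 ▸ 7791
  ▸ 10916 ▸ 8416 ▸ 7916 ▸ 4666 ▸ 12466 ▸ 14966 ▸ 15466 ▸ 14776 ▸ 5405 ▸ 14500 ▸ 8250 ▸ 12280 ▸ 15405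
  ▸ 6030 ▸ qed) (5426 ▸ 4691 ▸ 4716 ▸ 5316 ▸ 4816 ▸ 4666 ▸ 12466 ▸ 11866 ▸ 12366 ▸ 6201 ▸ 5405 ▸
  1650 ▸ 2150 ▸ 6080 ▸ 5580 ▸ 6030 ▸ qed)) (8191 ▸ 6691 ▸ 8551 ▸ 11316 ▸ 11336 ▸ 11576 ▸ 13241 ▸
  9430 ▸ 10116 ▸ 7286 ▸ 8536 ▸ 8336 ▸ 8411 ▸ 7791 ▸ 8311 ▸ 9791 ▸ 11526 ▸ 9816 ▸ 576 ▸ 9566 ▸ qed))
  (4205 ▸ 11291 ▸ 11866 ▸ 7911 ▸ 11556 ▸ 15456 ▸ 10616 ▸ 10916 ▸ 11541 ▸ 11536 ▸ 8431 ▸ 15466 ▸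
  12491 ▸ 12166 ▸ 15291 ▸ 9831 ▸ 7955 ▸ 4830 ▸ 11080 ▸ qed)) (11531 ▸ 406 ▸ 11656 ▸ 11630 ▸ 11626 ▸
  15541 ▸ 7841 ▸ 11711 ▸ qed)) (5331 ▸ 3506 ▸ 5456 ▸ 2326 ▸ 2330 ▸ 10941 ▸ 6241 ▸ 11711 ▸ qed))
  (11451 ▸ 11331 ▸ 11455 ▸ 7691 ▸ 7931 ▸ 15491 ▸ 11581 ▸ 516 ▸ 266 ▸ 11461 ▸ 11586 ▸ 11711 ▸ qed)))
  (10591 ▸ 12091 ▸ 3530 ▸ 10091 ▸ 5405 ▸ 11966 ▸ 4780 ▸ 5280 ▸ 11956 ▸ 10580 ▸ 12205 ▸ 11205 ▸ 10330
  ▸ 10830 ▸ 2880 ▸ qed))) (4791 ▸ 5291 ▸ 5026 ▸ 3541 ▸ 5041 ▸ 3416 ▸ 4416 ▸ 9956 ▸ 11956 ▸ 9650 ▸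
  12900 ▸ 9961 ▸ 9591 ▸ 5030 ▸ 12091 ▸ 7066 ▸ split 4536 (12086 ▸ 9586 ▸ 3536 ▸ 5161 ▸ 5411 ▸ qed)
  (10836 ▸ 5541 ▸ 5616 ▸ 14916 ▸ 8691 ▸ 4066 ▸ 7166 ▸ 8551 ▸ 13576 ▸ 13701 ▸ 11701 ▸ 13326 ▸ 10201 ▸
  qed))) (12291 ▸ 10291 ▸ 5130 ▸ 1026 ▸ 9791 ▸ 10416 ▸ 10041 ▸ 11456 ▸ 10456 ▸ 11331 ▸ 9831 ▸ 8866 ▸
  7931 ▸ 6616 ▸ 9116 ▸ qed)) (4591 ▸ 5591 ▸ 5126 ▸ 1030 ▸ 5216 ▸ 3341 ▸ 5091 ▸ 11456 ▸ 10456 ▸ 11331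
  ▸ 9831 ▸ 13816 ▸ 7931 ▸ 13066 ▸ 14316 ▸ qed)) (11791 ▸ 10791 ▸ 4130 ▸ 2026 ▸ 11416 ▸ 11291 ▸ 9541
  ▸ 11456 ▸ 10456 ▸ 11331 ▸ 9831 ▸ 7616 ▸ 7931 ▸ 6866 ▸ 8116 ▸ qed)) (6091 ▸ 4091 ▸ 2030 ▸ 4126 ▸
  3591 ▸ 4216 ▸ 3841 ▸ 11456 ▸ 10456 ▸ 11331 ▸ 9831 ▸ 15066 ▸ 7931 ▸ 12816 ▸ 15316 ▸ qed)))) (8556 ▸
  8431 ▸ split 3281 (9841 ▸ 3291 ▸ 9531 ▸ 3331 ▸ 3531 ▸ 6706 ▸ 9806 ▸ 9706 ▸ 12516 ▸ 6266 ▸ 516 ▸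
  266 ▸ 3586 ▸ 6711 ▸ 9586 ▸ 9711 ▸ 12961 ▸ 9961 ▸ 12956 ▸ 9956 ▸ 12931 ▸ qed) (9831 ▸ split 6426
  (8941 ▸ 10591 ▸ 3530 ▸ 9591 ▸ 9966 ▸ 6441 ▸ 9706 ▸ 9956 ▸ 266 ▸ 9955 ▸ 9961 ▸ 9711 ▸ 13616 ▸ 6686
  ▸ 9836 ▸ 8561 ▸ 12741 ▸ 8436 ▸ 13491 ▸ 10341 ▸ qed) (8316 ▸ split 4561 (10811 ▸ 14941 ▸ split 7661
  (8741 ▸ 7711 ▸ split 7781 (7831 ▸ split 136 (386 ▸ 516 ▸ 11506 ▸ 9706 ▸ 4131 ▸ 11391 ▸ 11516 ▸
  11511 ▸ 4016 ▸ 4091 ▸ 4086 ▸ 13616 ▸ 14241 ▸ 4791 ▸ 5291 ▸ 5026 ▸ 3416 ▸ 3541 ▸ qed) (2086 ▸ 11386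
  ▸ 791 ▸ 3891 ▸ 2091 ▸ 11631 ▸ 11636 ▸ split 4536 (4586 ▸ 5141 ▸ 11011 ▸ 5766 ▸ 1266 ▸ 11006 ▸ qed)
  (5616 ▸ 14916 ▸ 14616 ▸ 10306 ▸ 7206 ▸ 14741 ▸ 1081 ▸ 8391 ▸ 4791 ▸ 10456 ▸ 8466 ▸ 5026 ▸ 5416 ▸
  10961 ▸ 2266 ▸ qed))) (11531 ▸ 11031 ▸ 406 ▸ 9781 ▸ 9656 ▸ 9706 ▸ 516 ▸ 12831 ▸ 2086 ▸ 3581 ▸ 791
  ▸ 3506 ▸ 2281 ▸ 5331 ▸ 2831 ▸ 1656 ▸ 2156 ▸ 10931 ▸ 2956 ▸ 1706 ▸ 2900 ▸ 1831 ▸ 2456 ▸ qed))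
  (11791 ▸ 10791 ▸ 11816 ▸ 4130 ▸ 2026 ▸ 11416 ▸ 10456 ▸ 10581 ▸ 12900 ▸ 13581 ▸ 8591 ▸ 11566 ▸ 7961
  ▸ 326 ▸ 8086 ▸ 11541 ▸ qed)) (4591 ▸ 5591 ▸ 5126 ▸ 1030 ▸ 8716 ▸ 5216 ▸ 10456 ▸ 10581 ▸ 9650 ▸
  13706 ▸ 11691 ▸ 8466 ▸ 11061 ▸ 9626 ▸ 14186 ▸ 5341 ▸ qed))))) (10831 ▸ 11831 ▸ 2006 ▸ 4150 ▸ 11456
  ▸ split 7811 (11691 ▸ 8591 ▸ 11431 ▸ 8331 ▸ split 4556 (13956 ▸ 14556 ▸ 15206 ▸ 12081 ▸ 10650 ▸
  qed) (14581 ▸ 8150 ▸ 14400 ▸ 15206 ▸ 12081 ▸ 8956 ▸ qed)) (7941 ▸ split 261 (386 ▸ 266 ▸ 11581 ▸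
  8431 ▸ 8066 ▸ 9706 ▸ 11461 ▸ 3531 ▸ 13291 ▸ 3991 ▸ 9581 ▸ 8331 ▸ 11431 ▸ 9556 ▸ 6456 ▸ 9806 ▸ 6706
  ▸ 12931 ▸ 6831 ▸ 12956 ▸ 13081 ▸ 6650 ▸ qed) (11586 ▸ 11836 ▸ split 3911 (3916 ▸ 3991 ▸ 11451 ▸
  11431 ▸ split 7161 (10286 ▸ 2211 ▸ 2341 ▸ 2081 ▸ 2056 ▸ 1456 ▸ 1116 ▸ 2916 ▸ 1741 ▸ 2941 ▸ 1666 ▸
  1066 ▸ 2576 ▸ qed) (10291 ▸ 1026 ▸ 13416 ▸ 10401 ▸ 8701 ▸ 8706 ▸ 8711 ▸ 6266 ▸ qed)) (11461 ▸
  15241 ▸ 516 ▸ 15366 ▸ 11581 ▸ qed))))) (10331 ▸ 12331 ▸ 1006 ▸ 5150 ▸ split 3931 (11691 ▸ 3991 ▸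
  8441 ▸ 13741 ▸ split 4536 (14366 ▸ 12336 ▸ 11081 ▸ 10461 ▸ 2516 ▸ qed) (11086 ▸ 1886 ▸ 1266 ▸
  10461 ▸ 11081 ▸ 9066 ▸ qed)) (10431 ▸ split 4056 (13456 ▸ 13556 ▸ 13706 ▸ 10581 ▸ 9650 ▸ qed)
  (split 7031 (13291 ▸ 8591 ▸ 13741 ▸ 8441 ▸ split 7806 (14366 ▸ 9066 ▸ 11086 ▸ 10461 ▸ 1886 ▸ qed)
  (11081 ▸ 2516 ▸ 1266 ▸ 10461 ▸ 11086 ▸ 12336 ▸ qed)) (13581 ▸ 7331 ▸ 12900 ▸ 6650 ▸ 10581 ▸ 13706
  ▸ 7456 ▸ qed))))) (1076 ▸ 2076 ▸ 2926 ▸ qed)) (10380 ▸ 11380 ▸ 9130 ▸ qed)))) (3576 ▸ 9776 ▸ 12826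
  ▸ qed)) (1916 ▸ 716 ▸ 2586 ▸ qed)) (3580 ▸ 9780 ▸ 12830 ▸ qed)) (416 ▸ 216 ▸ 586 ▸ qed)) (5080 ▸
  11280 ▸ 13830 ▸ qed)) (10076 ▸ 11276 ▸ 8826 ▸ qed)) (2256 ▸ 1016 ▸ 2766 ▸ qed)) (2080 ▸ 2280 ▸
  1830 ▸ qed)) (10016 ▸ 11256 ▸ 8766 ▸ qed)) (9416 ▸ 3216 ▸ 12586 ▸ qed)) (9516 ▸ 9756 ▸ 6766 ▸
  qed)) (11376 ▸ 5376 ▸ 14126 ▸ qed)) (10400 ▸ 11400 ▸ 9150 ▸ qed)

sumAgrees : Refutation
sumAgrees =
  -- Codes are read in base 5, the lowest digit for the first coordinate. The first branch can be
  -- followed by hand: 156 stands for e₁ + e₂ + e₃ + e₄, taken to be `true`. The planes of e₁ + e₃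
  -- and e₂ + e₄ (416) and of e₁ + e₄ and e₂ + e₃ (216) force e₁ - e₂ + e₃ - e₄ and e₁ - e₂ - e₃ +
  -- e₄ to be `false`; these are the sum and difference of e₁ - e₂ and e₃ - e₄, both `false`, so
  -- plane 586 is monochromatic.
  split 156 (416 ▸ 216 ▸ 586 ▸ qed) (split 780 (2080 ▸ 2280 ▸ 1830 ▸ qed) (split 3276 (3576 ▸ 9776 ▸
  12826 ▸ qed) (split 3876 (11376 ▸ 5376 ▸ 14126 ▸ qed) (split 3156 (9416 ▸ 3216 ▸ 12586 ▸ qed)
  (split 3256 (9516 ▸ 9756 ▸ 6766 ▸ qed) (split 3900 (10400 ▸ 11400 ▸ 9150 ▸ qed) (split 4531 (split
  3776 (10076 ▸ 11276 ▸ 8826 ▸ qed) (split 3756 (10016 ▸ 11256 ▸ 8766 ▸ qed) (split 776 (1076 ▸ 2076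
  ▸ 2926 ▸ qed) (split 656 (1916 ▸ 716 ▸ 2586 ▸ qed) (split 756 (2256 ▸ 1016 ▸ 2766 ▸ qed) (split
  7031 (split 3911 (split 4536 (5161 ▸ 4541 ▸ split 151 (201 ▸ 14541 ▸ 401 ▸ 451 ▸ split 7056 (7081
  ▸ 14616 ▸ 8830 ▸ split 7181 (14991 ▸ 7306 ▸ 14441 ▸ split 3936 (3961 ▸ 15216 ▸ 13266 ▸ 2001 ▸
  13341 ▸ 1001 ▸ 13966 ▸ 14591 ▸ 4586 ▸ 4811 ▸ 14716 ▸ 13891 ▸ 7206 ▸ 14916 ▸ 13391 ▸ 9130 ▸ 15391 ▸
  qed) (split 7781 (15541 ▸ 8531 ▸ 15566 ▸ 8556 ▸ 8431 ▸ 12566 ▸ 12816 ▸ 3561 ▸ 12691 ▸ 8306 ▸ 15191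
  ▸ 15166 ▸ 9156 ▸ 8456 ▸ 8406 ▸ 12766 ▸ 12791 ▸ 3461 ▸ qed) (split 4036 (4161 ▸ 13616 ▸ 6830 ▸
  split 4661 (14866 ▸ 7455 ▸ 8405 ▸ 9330 ▸ 9080 ▸ 2275 ▸ 8455 ▸ 8580 ▸ 7280 ▸ 14841 ▸ 14716 ▸ 13666
  ▸ 7281 ▸ 13166 ▸ qed) (14666 ▸ 7281 ▸ 14916 ▸ 13166 ▸ 9130 ▸ 1901 ▸ 13541 ▸ 15416 ▸ 14166 ▸ qed))
  (4336 ▸ 15291 ▸ 15016 ▸ 7580 ▸ 13766 ▸ 15366 ▸ 5011 ▸ 4461 ▸ 8556 ▸ 5711 ▸ 12566 ▸ 5061 ▸ qed))))
  (14691 ▸ 14741 ▸ 4711 ▸ 14641 ▸ split 131 (12081 ▸ 381 ▸ 391 ▸ 12206 ▸ 14636 ▸ 4716 ▸ 7141 ▸ 14626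
  ▸ qed) (14506 ▸ 4581 ▸ 12256 ▸ split 4561 (4586 ▸ 12261 ▸ 7141 ▸ 12266 ▸ 7241 ▸ 12316 ▸ 7211 ▸
  qed) (14941 ▸ 14891 ▸ 12261 ▸ 7141 ▸ 12266 ▸ 7241 ▸ 12316 ▸ 7211 ▸ qed)))) (14566 ▸ 14591 ▸ 4586 ▸
  split 7156 (14966 ▸ 7281 ▸ 14916 ▸ 7455 ▸ 9130 ▸ split 7681 (8331 ▸ 15241 ▸ 8956 ▸ 7706 ▸ 15166 ▸
  15416 ▸ 13891 ▸ 15291 ▸ 15366 ▸ 13991 ▸ 13966 ▸ 7906 ▸ 7956 ▸ 7931 ▸ 13866 ▸ 13841 ▸ 13766 ▸ 4461
  ▸ qed) (split 4686 (4836 ▸ 4811 ▸ 13766 ▸ 14441 ▸ split 3936 (5436 ▸ 5186 ▸ 13716 ▸ 12566 ▸ 12691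
  ▸ 6830 ▸ 6681 ▸ 12991 ▸ 12866 ▸ 13066 ▸ 13241 ▸ 13666 ▸ 13166 ▸ qed) (15191 ▸ 7880 ▸ 15016 ▸ 15566
  ▸ 4336 ▸ 8456 ▸ 5336 ▸ 12766 ▸ qed)) (14691 ▸ 14816 ▸ 14991 ▸ 14791 ▸ 7080 ▸ 14241 ▸ 8305 ▸ 9180 ▸
  8705 ▸ 8555 ▸ 1025 ▸ 8580 ▸ qed))) (14666 ▸ 7456 ▸ 14716 ▸ 4711 ▸ 4786 ▸ 7331 ▸ 4836 ▸ 4811 ▸
  13766 ▸ 14441 ▸ 6956 ▸ split 7681 (8331 ▸ 15241 ▸ 8956 ▸ 7706 ▸ 7956 ▸ 14141 ▸ 15366 ▸ 13541 ▸
  4161 ▸ 13166 ▸ qed) (9181 ▸ 8181 ▸ 13816 ▸ 13866 ▸ 1951 ▸ 13241 ▸ 13166 ▸ qed)))) (14526 ▸ 12666 ▸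
  7041 ▸ 8281 ▸ 8916 ▸ 6416 ▸ 8276 ▸ split 6400 (12951 ▸ 12826 ▸ 12926 ▸ 6651 ▸ 6451 ▸ 9151 ▸ 6791 ▸
  6491 ▸ 8951 ▸ 8401 ▸ 7276 ▸ 6456 ▸ 8301 ▸ 8076 ▸ 7416 ▸ 8956 ▸ 8406 ▸ 8416 ▸ 8306 ▸ 8316 ▸ 8081 ▸
  8086 ▸ 7516 ▸ qed) (14201 ▸ 12961 ▸ 14826 ▸ 14836 ▸ 4691 ▸ 5311 ▸ 5941 ▸ 14206 ▸ 13586 ▸ 3441 ▸
  1881 ▸ split 7061 (10211 ▸ 7091 ▸ 13336 ▸ 7116 ▸ 5436 ▸ 7066 ▸ 6061 ▸ 8951 ▸ 5186 ▸ 9501 ▸ 3691 ▸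
  3366 ▸ 3566 ▸ qed) (13561 ▸ 711 ▸ 13536 ▸ 5336 ▸ 5961 ▸ 5286 ▸ 3491 ▸ 3466 ▸ 3501 ▸ 3666 ▸ 5826 ▸
  3366 ▸ 9401 ▸ 6041 ▸ 3201 ▸ 9151 ▸ 9166 ▸ 6066 ▸ 13701 ▸ 7166 ▸ 5181 ▸ 13706 ▸ qed)))) (split 7661
  (11411 ▸ 10791 ▸ 14536 ▸ 13916 ▸ 10161 ▸ 10781 ▸ 2666 ▸ 201 ▸ 401 ▸ 451 ▸ 15166 ▸ 12041 ▸ split
  4661 (4791 ▸ 5411 ▸ 4916 ▸ 6036 ▸ 12416 ▸ 15416 ▸ 14130 ▸ qed) (split 4561 (4591 ▸ 5211 ▸ 4616 ▸
  5836 ▸ 12116 ▸ 15216 ▸ 13830 ▸ qed) (split 7181 (13741 ▸ 12331 ▸ 14366 ▸ 12336 ▸ 7956 ▸ 7336 ▸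
  8766 ▸ qed) (14741 ▸ split 4036 (15416 ▸ 14130 ▸ 12416 ▸ 12166 ▸ 10286 ▸ 12291 ▸ 2791 ▸ split 7186
  (10336 ▸ 7211 ▸ 7336 ▸ 2766 ▸ 12141 ▸ 8766 ▸ 10881 ▸ 7956 ▸ 15266 ▸ 15316 ▸ 4086 ▸ qed) (12316 ▸
  12216 ▸ 12366 ▸ 6116 ▸ 11955 ▸ 12091 ▸ 4955 ▸ 1830 ▸ 12086 ▸ 12461 ▸ 12455 ▸ 10905 ▸ 141 ▸ 9330 ▸
  2706 ▸ 3081 ▸ qed)) (6036 ▸ 15291 ▸ split 4061 (4211 ▸ 4336 ▸ 4186 ▸ 15216 ▸ 15066 ▸ 13830 ▸ 12116
  ▸ 12066 ▸ 10186 ▸ 12091 ▸ 2691 ▸ split 7186 (7311 ▸ 10436 ▸ 11941 ▸ 2566 ▸ 10681 ▸ qed) (12216 ▸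
  10906 ▸ 6216 ▸ 2791 ▸ 1830 ▸ 2991 ▸ qed)) (6061 ▸ 15316 ▸ 3211 ▸ 15616 ▸ 7956 ▸ 5586 ▸ 8766 ▸ 1025
  ▸ 7336 ▸ 8580 ▸ 2336 ▸ 12191 ▸ 14841 ▸ 10931 ▸ 14686 ▸ 2816 ▸ 2186 ▸ qed)))))) (split 4561 (4591 ▸
  5211 ▸ 4616 ▸ 5836 ▸ 4566 ▸ 4581 ▸ 3961 ▸ 5766 ▸ 5841 ▸ 3501 ▸ 5866 ▸ 9501 ▸ split 4661 (4791 ▸
  5411 ▸ 4916 ▸ 6036 ▸ 6216 ▸ 6116 ▸ 1830 ▸ qed) (14161 ▸ split 7056 (7081 ▸ 14506 ▸ 13266 ▸ 12081 ▸
  391 ▸ 13366 ▸ 2251 ▸ 12211 ▸ 14116 ▸ 10436 ▸ 11056 ▸ 2566 ▸ qed) (8366 ▸ 1991 ▸ 13556 ▸ split 4061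
  (4066 ▸ 6051 ▸ 5566 ▸ 3201 ▸ 5541 ▸ 4081 ▸ 4266 ▸ 6006 ▸ 11251 ▸ 4366 ▸ 6081 ▸ 9391 ▸ 8116 ▸ 9211
  ▸ 11056 ▸ 10436 ▸ 2566 ▸ qed) (15461 ▸ 5966 ▸ 15456 ▸ 6216 ▸ 8956 ▸ 8966 ▸ 1830 ▸ 8331 ▸ 12466 ▸
  6116 ▸ 8991 ▸ 15441 ▸ 14155 ▸ 5991 ▸ 12491 ▸ 7705 ▸ 14180 ▸ qed)))) (13961 ▸ split 7181 (13741 ▸
  7331 ▸ 12331 ▸ 14366 ▸ 12336 ▸ 15616 ▸ 8431 ▸ 12341 ▸ 7191 ▸ 11080 ▸ 9525 ▸ 10461 ▸ split 4686
  (14841 ▸ 14530 ▸ 8580 ▸ 4841 ▸ 405 ▸ 5461 ▸ 1025 ▸ 4966 ▸ 5586 ▸ 10956 ▸ 10336 ▸ 2766 ▸ qed)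
  (14211 ▸ 1636 ▸ 14086 ▸ split 4061 (13591 ▸ 14216 ▸ 15466 ▸ 7956 ▸ 7916 ▸ 14205 ▸ 8766 ▸ 8826 ▸
  8041 ▸ 7336 ▸ 7316 ▸ 7791 ▸ 14836 ▸ 7116 ▸ 9076 ▸ 14831 ▸ 7091 ▸ 9091 ▸ 12441 ▸ 14155 ▸ 4705 ▸
  qed) (13586 ▸ 8536 ▸ 7336 ▸ 9161 ▸ 6366 ▸ 8766 ▸ 8411 ▸ 8556 ▸ 7956 ▸ 6616 ▸ 8956 ▸ 7456 ▸ 8491 ▸
  8456 ▸ 8366 ▸ 6766 ▸ 6391 ▸ qed))) (8741 ▸ 14941 ▸ split 4661 (14791 ▸ 4791 ▸ 5411 ▸ 4916 ▸ 6036 ▸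
  4781 ▸ 4161 ▸ 5666 ▸ 9401 ▸ 6166 ▸ split 7156 (7281 ▸ 14406 ▸ 13166 ▸ 81 ▸ 12281 ▸ 13666 ▸ 701 ▸
  12306 ▸ 13691 ▸ 6116 ▸ 6216 ▸ 1830 ▸ qed) (8666 ▸ 2391 ▸ 955 ▸ 13456 ▸ 8716 ▸ split 7036 (8336 ▸
  10616 ▸ 12886 ▸ 12930 ▸ 5336 ▸ 13616 ▸ 14816 ▸ qed) (9291 ▸ 8531 ▸ 9156 ▸ 7716 ▸ 15456 ▸ 14126 ▸
  14150 ▸ 4716 ▸ 12456 ▸ 14816 ▸ qed))) (14161 ▸ 14741 ▸ 4961 ▸ split 4511 (10761 ▸ 14891 ▸ 4761 ▸
  14136 ▸ 8641 ▸ 14641 ▸ 11011 ▸ 1005 ▸ 14516 ▸ 8516 ▸ qed) (split 7781 (15541 ▸ 11031 ▸ 8531 ▸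
  split 7656 (10781 ▸ split 3936 (3961 ▸ 15216 ▸ 13830 ▸ split 751 (2001 ▸ 13891 ▸ 7706 ▸ 14241 ▸
  13991 ▸ 7741 ▸ 9181 ▸ 6680 ▸ 12616 ▸ 7641 ▸ 14366 ▸ 6036 ▸ 7831 ▸ 15416 ▸ 8016 ▸ 15441 ▸ 11251 ▸
  4086 ▸ 4266 ▸ 15386 ▸ 15381 ▸ qed) (13266 ▸ 7081 ▸ split 7036 (10161 ▸ 12116 ▸ 866 ▸ 2666 ▸ 14556
  ▸ 2056 ▸ 201 ▸ 12041 ▸ 2691 ▸ 12066 ▸ 10186 ▸ qed) (7116 ▸ 14536 ▸ 7016 ▸ 7091 ▸ 14511 ▸ 14561 ▸
  211 ▸ qed))) (5836 ▸ 15566 ▸ 15616 ▸ 7831 ▸ 7956 ▸ 14266 ▸ 8766 ▸ 13016 ▸ 6766 ▸ 12766 ▸ 9511 ▸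
  3511 ▸ 14511 ▸ 15211 ▸ 6011 ▸ 6211 ▸ 8261 ▸ 7261 ▸ 11275 ▸ 5261 ▸ 2275 ▸ 14136 ▸ 12261 ▸ 11580 ▸
  8580 ▸ 1636 ▸ 1336 ▸ 5125 ▸ 14841 ▸ 14086 ▸ 14186 ▸ 11680 ▸ 11741 ▸ 11841 ▸ 4331 ▸ qed)) (9156 ▸
  14156 ▸ 7281 ▸ 4781 ▸ 14406 ▸ 91 ▸ 12281 ▸ 41 ▸ 12311 ▸ 12286 ▸ 12261 ▸ 7211 ▸ qed)) (14041 ▸
  14341 ▸ 8041 ▸ 9081 ▸ split 7156 (8456 ▸ 7281 ▸ 14366 ▸ 6580 ▸ 14316 ▸ 1951 ▸ 13166 ▸ 4161 ▸ 15366
  ▸ 6036 ▸ 15116 ▸ 8180 ▸ 5036 ▸ 13866 ▸ qed) (split 7036 (10161 ▸ split 151 (401 ▸ 12041 ▸ 14666 ▸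
  14391 ▸ 6955 ▸ 7456 ▸ 14716 ▸ 7081 ▸ 14841 ▸ split 4656 (12456 ▸ 4716 ▸ 12461 ▸ 4741 ▸ 7086 ▸ 4706
  ▸ 14511 ▸ 4891 ▸ 12141 ▸ 141 ▸ 4841 ▸ 14506 ▸ 14530 ▸ 4581 ▸ 12266 ▸ 12341 ▸ 12316 ▸ qed) (4916 ▸
  10651 ▸ 14291 ▸ 13016 ▸ 6580 ▸ 5836 ▸ 14366 ▸ 5436 ▸ 8556 ▸ 12566 ▸ qed)) (2666 ▸ 10781 ▸ 13916 ▸
  1416 ▸ 1651 ▸ 1791 ▸ 14291 ▸ 1541 ▸ 1656 ▸ 13016 ▸ 6580 ▸ 14156 ▸ 5836 ▸ 14366 ▸ 6216 ▸ 10956 ▸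
  9341 ▸ 14081 ▸ 10186 ▸ 10931 ▸ 3086 ▸ 1616 ▸ 3081 ▸ 2251 ▸ 866 ▸ qed)) (7416 ▸ 14536 ▸ 8151 ▸ 7291
  ▸ 8666 ▸ 7241 ▸ 14661 ▸ 14961 ▸ 2391 ▸ 955 ▸ 411 ▸ 13456 ▸ 8716 ▸ 12286 ▸ 12275 ▸ 12251 ▸ 12336 ▸
  4616 ▸ 10316 ▸ 10816 ▸ 2926 ▸ qed)))))))))) (4291 ▸ 11711 ▸ 3991 ▸ split 7186 (12341 ▸ 8436 ▸
  split 3255 (9755 ▸ 10441 ▸ 3505 ▸ 9505 ▸ split 3155 (10341 ▸ 9455 ▸ 9405 ▸ split 155 (7341 ▸ 405 ▸
  455 ▸ split 7181 (10331 ▸ 7331 ▸ split 7156 (7206 ▸ 7216 ▸ 13391 ▸ 7391 ▸ 9126 ▸ 14626 ▸ split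
  7631 (15391 ▸ 7641 ▸ 14130 ▸ 11141 ▸ 12391 ▸ qed) (14141 ▸ 5261 ▸ 4641 ▸ 12886 ▸ 11141 ▸ 8261 ▸
  qed)) (13456 ▸ 13466 ▸ 7456 ▸ 7466 ▸ 4066 ▸ 7066 ▸ 13551 ▸ qed)) (7491 ▸ 13491 ▸ 13691 ▸ 7041 ▸
  7336 ▸ 4041 ▸ 10336 ▸ 3941 ▸ 13326 ▸ 8766 ▸ 14386 ▸ 4326 ▸ 2886 ▸ 2001 ▸ 11251 ▸ split 7756 (7881
  ▸ 14141 ▸ 13891 ▸ 4761 ▸ qed) (14266 ▸ 8016 ▸ 10761 ▸ qed))) (6716 ▸ 14530 ▸ 8281 ▸ 14841 ▸ 14216
  ▸ 12966 ▸ 13591 ▸ 12841 ▸ 12941 ▸ 13466 ▸ 13566 ▸ 8406 ▸ 8306 ▸ 10281 ▸ 10181 ▸ 14091 ▸ 1206 ▸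
  10966 ▸ 1881 ▸ 10581 ▸ 11206 ▸ qed)) (9716 ▸ 6030 ▸ 5281 ▸ 11841 ▸ 11216 ▸ 10591 ▸ 5280 ▸ 9966 ▸
  10566 ▸ 5955 ▸ 9941 ▸ 11866 ▸ 5306 ▸ 11166 ▸ 11191 ▸ 11041 ▸ 11066 ▸ 8086 ▸ 11116 ▸ 4956 ▸ 10491 ▸
  7461 ▸ 11891 ▸ 8136 ▸ 4955 ▸ 8711 ▸ 5580 ▸ qed)) (9816 ▸ 5830 ▸ 5181 ▸ 11741 ▸ 11116 ▸ 5180 ▸ 9866
  ▸ 10491 ▸ split 3155 (10341 ▸ 3205 ▸ 10366 ▸ 6055 ▸ 9741 ▸ 11866 ▸ 5306 ▸ 10866 ▸ 10991 ▸ 10841 ▸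
  10966 ▸ 8086 ▸ 11216 ▸ 4956 ▸ 10591 ▸ 7461 ▸ 11891 ▸ 8136 ▸ 4955 ▸ 9336 ▸ 6205 ▸ qed) (9716 ▸ 6030
  ▸ 5281 ▸ 11841 ▸ 11216 ▸ 4956 ▸ 10591 ▸ 5280 ▸ 7461 ▸ 4955 ▸ 11891 ▸ qed))) (split 4061 (6091 ▸
  11561 ▸ 9216 ▸ 14686 ▸ 15466 ▸ 10781 ▸ 10936 ▸ 14841 ▸ 1716 ▸ 7966 ▸ 4841 ▸ 405 ▸ 455 ▸ split 7686
  (7716 ▸ 11841 ▸ 14126 ▸ 13530 ▸ 4716 ▸ 8341 ▸ 705 ▸ 1905 ▸ 1955 ▸ 12216 ▸ 4966 ▸ 14155 ▸ 4780 ▸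
  12091 ▸ 4811 ▸ 6030 ▸ 10841 ▸ 9405 ▸ 13841 ▸ 9155 ▸ 7906 ▸ 14966 ▸ 9091 ▸ 7466 ▸ 9751 ▸ 10001 ▸
  5866 ▸ 4366 ▸ 4566 ▸ 5316 ▸ 13951 ▸ 12926 ▸ 7666 ▸ 8316 ▸ 8366 ▸ qed) (8091 ▸ 9186 ▸ 8561 ▸ split
  7661 (11791 ▸ 7961 ▸ 11816 ▸ 8086 ▸ 11866 ▸ 15456 ▸ 11741 ▸ 9150 ▸ 13330 ▸ 1005 ▸ 2005 ▸ 13455 ▸
  13955 ▸ 14955 ▸ qed) (8116 ▸ 8961 ▸ 7831 ▸ 7956 ▸ 8016 ▸ 13766 ▸ 8261 ▸ 4836 ▸ 9266 ▸ 12336 ▸ 4991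
  ▸ 2255 ▸ 12331 ▸ 10931 ▸ 13330 ▸ 2316 ▸ 8741 ▸ 1866 ▸ 11741 ▸ 10181 ▸ 2116 ▸ 2491 ▸ 8616 ▸ 2241 ▸
  2366 ▸ qed))) (split 7161 (12291 ▸ 8461 ▸ 7291 ▸ 12316 ▸ 9086 ▸ 12366 ▸ 4581 ▸ 11741 ▸ 7836 ▸
  11016 ▸ 11041 ▸ 9755 ▸ 11066 ▸ 9505 ▸ split 7156 (14956 ▸ 8416 ▸ 9150 ▸ 12826 ▸ 6826 ▸ split 7806
  (8456 ▸ 11056 ▸ 12766 ▸ 1366 ▸ 11036 ▸ 12336 ▸ 14291 ▸ 10775 ▸ 6086 ▸ 3511 ▸ 5836 ▸ 15591 ▸ 14330
  ▸ 13711 ▸ 9775 ▸ 10461 ▸ qed) (9066 ▸ 14316 ▸ 9676 ▸ 8441 ▸ 6676 ▸ 11061 ▸ 15316 ▸ 11255 ▸ 4330 ▸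
  11841 ▸ 14186 ▸ 8691 ▸ 14841 ▸ 1005 ▸ 13330 ▸ qed)) (13666 ▸ 7416 ▸ 701 ▸ 8536 ▸ 13566 ▸ 12586 ▸
  6366 ▸ 8556 ▸ 9066 ▸ 14316 ▸ 8441 ▸ 14591 ▸ 13691 ▸ 14716 ▸ 5436 ▸ qed)) (13461 ▸ split 636 (641 ▸
  1011 ▸ split 7061 (8561 ▸ 12091 ▸ 9186 ▸ 12216 ▸ 7936 ▸ 4781 ▸ 10716 ▸ 9455 ▸ 3205 ▸ 9405 ▸ split
  7056 (10181 ▸ 7081 ▸ 1206 ▸ 13506 ▸ 10281 ▸ 4081 ▸ 13456 ▸ 13466 ▸ 891 ▸ qed) (13366 ▸ 1001 ▸
  10366 ▸ 13466 ▸ 4181 ▸ 7281 ▸ 13206 ▸ qed)) (7461 ▸ 13561 ▸ 10011 ▸ 711 ▸ split 7036 (7041 ▸ split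
  751 (10241 ▸ 1001 ▸ 10366 ▸ 4181 ▸ 4081 ▸ 13206 ▸ 13506 ▸ 7281 ▸ 7081 ▸ 13466 ▸ 7456 ▸ 13216 ▸
  13341 ▸ 6956 ▸ 7331 ▸ 13191 ▸ 13316 ▸ 13441 ▸ 1051 ▸ qed) (13326 ▸ 3941 ▸ 4336 ▸ 4041 ▸ 13526 ▸
  13541 ▸ 10541 ▸ 701 ▸ 13566 ▸ 10566 ▸ 7081 ▸ 4081 ▸ 13506 ▸ qed)) (13536 ▸ 13336 ▸ 4041 ▸ 3941 ▸
  4326 ▸ 4341 ▸ 10001 ▸ 4241 ▸ 7466 ▸ 7366 ▸ 10281 ▸ 10181 ▸ 1206 ▸ qed))) (10461 ▸ 9525 ▸ 9775 ▸
  13586 ▸ 13711 ▸ 7041 ▸ 3941 ▸ 13326 ▸ 13341 ▸ 10241 ▸ 1001 ▸ 13466 ▸ 10366 ▸ 13716 ▸ 10616 ▸ 12830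
  ▸ qed)))))) (13331 ▸ 13291 ▸ 13531 ▸ 8591 ▸ split 7186 (12341 ▸ 8436 ▸ split 3255 (9755 ▸ 10441 ▸
  3505 ▸ 9505 ▸ split 3275 (9525 ▸ 9775 ▸ 3525 ▸ 10461 ▸ split 3155 (10341 ▸ 9455 ▸ 3205 ▸ 9405 ▸
  split 4061 (4191 ▸ 4211 ▸ split 3936 (10436 ▸ 4186 ▸ 2586 ▸ 2566 ▸ 13211 ▸ 13191 ▸ split 7556
  (10681 ▸ 8181 ▸ 10741 ▸ 6366 ▸ 8161 ▸ qed) (13866 ▸ 14491 ▸ 10661 ▸ 14430 ▸ 10741 ▸ 11991 ▸ qed))
  (13711 ▸ 4336 ▸ 13691 ▸ 4316 ▸ 10286 ▸ 10306 ▸ 991 ▸ qed)) (13586 ▸ 13466 ▸ 13566 ▸ 10161 ▸ 7216 ▸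
  10181 ▸ 7316 ▸ 866 ▸ 9126 ▸ 14626 ▸ 8826 ▸ 14426 ▸ 2001 ▸ 2251 ▸ split 4676 (4801 ▸ 4701 ▸ 13951 ▸
  11201 ▸ 7701 ▸ qed) (14076 ▸ 14201 ▸ 7901 ▸ qed))) (9716 ▸ 6030 ▸ 5281 ▸ 11841 ▸ 11216 ▸ 10591 ▸
  5280 ▸ 10586 ▸ 10566 ▸ 11205 ▸ 5955 ▸ 4161 ▸ 15491 ▸ 11866 ▸ 4181 ▸ 3866 ▸ 11166 ▸ 11251 ▸ 4241 ▸
  11041 ▸ 7991 ▸ qed)) (11080 ▸ 9836 ▸ 15616 ▸ 5161 ▸ 14366 ▸ 13741 ▸ 13116 ▸ 8430 ▸ 13691 ▸ 13066 ▸
  9080 ▸ 15591 ▸ 5186 ▸ 14291 ▸ 14316 ▸ 11041 ▸ 11066 ▸ 7866 ▸ 11116 ▸ 4616 ▸ 10491 ▸ 7241 ▸ 8376 ▸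
  12251 ▸ 9116 ▸ 12305 ▸ 11055 ▸ qed)) (9816 ▸ 5830 ▸ 5181 ▸ 11741 ▸ 11116 ▸ 5180 ▸ 9866 ▸ 10491 ▸
  split 3275 (9525 ▸ 9775 ▸ 10461 ▸ 13711 ▸ 13086 ▸ 14330 ▸ 3961 ▸ 15591 ▸ 5186 ▸ 14331 ▸ 14341 ▸
  1881 ▸ 13091 ▸ 13716 ▸ 13581 ▸ 4081 ▸ 4266 ▸ 11251 ▸ 4341 ▸ 10001 ▸ 8091 ▸ 6841 ▸ 7466 ▸ 8311 ▸
  qed) (11080 ▸ 9836 ▸ 15616 ▸ 5161 ▸ 14366 ▸ 7866 ▸ 13741 ▸ 13116 ▸ 7241 ▸ 6616 ▸ 8376 ▸ qed)))
  (split 7181 (8441 ▸ 12331 ▸ 9066 ▸ 12336 ▸ 7816 ▸ 15616 ▸ 8431 ▸ 14991 ▸ 5161 ▸ 4541 ▸ 11076 ▸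
  9525 ▸ 9775 ▸ 11081 ▸ 11086 ▸ split 7786 (11741 ▸ 7836 ▸ 11036 ▸ 11680 ▸ 1366 ▸ 5125 ▸ 10125 ▸
  11056 ▸ 12305 ▸ 12316 ▸ 14331 ▸ 4580 ▸ 12291 ▸ 7831 ▸ 5830 ▸ 9755 ▸ 14266 ▸ 9080 ▸ 4586 ▸ 15591 ▸
  12311 ▸ 13711 ▸ 91 ▸ 641 ▸ 14781 ▸ 13581 ▸ 10906 ▸ 5616 ▸ 4081 ▸ 1831 ▸ 2930 ▸ 11516 ▸ 2991 ▸
  11541 ▸ 2791 ▸ qed) (14336 ▸ 9086 ▸ 4586 ▸ 5191 ▸ 8461 ▸ split 4556 (4581 ▸ 5181 ▸ 3366 ▸ 9751 ▸
  9501 ▸ 6616 ▸ 6586 ▸ 9816 ▸ 9755 ▸ 14266 ▸ 13066 ▸ 9080 ▸ 7831 ▸ 5186 ▸ 9091 ▸ 15586 ▸ 13711 ▸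
  1905 ▸ 15580 ▸ 641 ▸ 8341 ▸ 11680 ▸ 13581 ▸ 10836 ▸ 5125 ▸ 4081 ▸ 2886 ▸ 12261 ▸ 6006 ▸ 10261 ▸
  3141 ▸ 6011 ▸ qed) (14331 ▸ 5816 ▸ 11116 ▸ 7831 ▸ 5186 ▸ 14266 ▸ 13086 ▸ 9755 ▸ 9866 ▸ 6586 ▸ 9816
  ▸ qed))) (split 7161 (12291 ▸ 8461 ▸ 12316 ▸ 9086 ▸ 4581 ▸ 5181 ▸ 11741 ▸ 7836 ▸ 11016 ▸ 11041 ▸
  9755 ▸ 9505 ▸ split 651 (10416 ▸ 701 ▸ 13691 ▸ 3961 ▸ 5766 ▸ 11636 ▸ 5841 ▸ 9751 ▸ 5125 ▸ 11686 ▸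
  9091 ▸ 12311 ▸ 11531 ▸ 7791 ▸ 4566 ▸ 5591 ▸ 14326 ▸ 9775 ▸ 10456 ▸ 13706 ▸ 8716 ▸ 14656 ▸ 10816 ▸
  10916 ▸ 1826 ▸ qed) (13541 ▸ 6116 ▸ 4161 ▸ 11536 ▸ 1830 ▸ 2930 ▸ 13166 ▸ 366 ▸ split 7656 (7916 ▸
  13826 ▸ 4816 ▸ 14686 ▸ 316 ▸ 14691 ▸ 10005 ▸ 14416 ▸ 4330 ▸ 11516 ▸ 13791 ▸ 11841 ▸ 4081 ▸ 7906 ▸
  11816 ▸ 8041 ▸ 11791 ▸ qed) (9216 ▸ 14166 ▸ 1655 ▸ 6091 ▸ 2955 ▸ 4791 ▸ 9206 ▸ 9381 ▸ 3706 ▸ 5281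
  ▸ 5966 ▸ 4916 ▸ 3501 ▸ 5161 ▸ 3366 ▸ qed))) (7241 ▸ split 6876 (7251 ▸ 10001 ▸ split 7061 (8561 ▸
  12091 ▸ 9186 ▸ 12216 ▸ 7936 ▸ 4781 ▸ 10716 ▸ 9455 ▸ 3205 ▸ 9405 ▸ split 3936 (3941 ▸ 3961 ▸ 4326 ▸
  4266 ▸ 4041 ▸ 4081 ▸ 13491 ▸ 4116 ▸ 10251 ▸ qed) (13341 ▸ 1001 ▸ 13491 ▸ 10366 ▸ 4161 ▸ 4181 ▸
  3866 ▸ qed)) (7461 ▸ 7441 ▸ 6891 ▸ 6951 ▸ split 7036 (10161 ▸ split 906 (10281 ▸ 7456 ▸ 10181 ▸
  866 ▸ 10241 ▸ 1001 ▸ 13366 ▸ 10366 ▸ 13491 ▸ 4181 ▸ 4161 ▸ 3866 ▸ qed) (1166 ▸ 10541 ▸ 701 ▸ 10566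
  ▸ 4181 ▸ 4081 ▸ 3866 ▸ 4266 ▸ 4161 ▸ 3961 ▸ 4336 ▸ 13691 ▸ 4136 ▸ 4211 ▸ 13666 ▸ 13641 ▸ 13391 ▸
  13441 ▸ 13416 ▸ 951 ▸ qed)) (7416 ▸ 7116 ▸ 10281 ▸ 10181 ▸ 1206 ▸ 641 ▸ 13706 ▸ 10581 ▸ 10586 ▸
  13711 ▸ 4041 ▸ 3941 ▸ 4326 ▸ qed))) (7341 ▸ 455 ▸ 205 ▸ 7491 ▸ 7366 ▸ 10161 ▸ 10181 ▸ 866 ▸ 10241
  ▸ 1001 ▸ 13366 ▸ 10366 ▸ 13491 ▸ 10616 ▸ 13616 ▸ 12930 ▸ qed))))))))))) (14531 ▸ 5791 ▸ 6031 ▸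
  5831 ▸ split 3280 (3580 ▸ 9780 ▸ 12830 ▸ qed) (11091 ▸ split 4036 (4041 ▸ 4161 ▸ split 651 (1901 ▸
  13541 ▸ 1951 ▸ 701 ▸ split 3751 (11251 ▸ 10001 ▸ 5001 ▸ 4241 ▸ split 3775 (11586 ▸ 10025 ▸ 5025 ▸
  split 4661 (14791 ▸ 10961 ▸ split 4686 (4711 ▸ 5336 ▸ 14141 ▸ 14636 ▸ 12886 ▸ 12766 ▸ split 7636
  (8261 ▸ 7641 ▸ 7391 ▸ 9126 ▸ 7141 ▸ qed) (8016 ▸ 7881 ▸ 8381 ▸ 8766 ▸ 7391 ▸ 7261 ▸ qed)) (14086 ▸
  14816 ▸ 14711 ▸ 14191 ▸ 8411 ▸ 8306 ▸ 6741 ▸ qed)) (4866 ▸ 14166 ▸ 12211 ▸ 5181 ▸ 8281 ▸ 15416 ▸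
  10336 ▸ 12706 ▸ 9130 ▸ 14130 ▸ 2886 ▸ 2766 ▸ 141 ▸ 381 ▸ split 4631 (12391 ▸ 10881 ▸ 14511 ▸ 8016
  ▸ 10761 ▸ qed) (14631 ▸ 4891 ▸ 14891 ▸ qed))) (11336 ▸ 11576 ▸ 7936 ▸ 7816 ▸ 8066 ▸ 7566 ▸ 7941 ▸
  13816 ▸ 7616 ▸ 7991 ▸ 14191 ▸ 4811 ▸ 7911 ▸ 11741 ▸ 14841 ▸ 14316 ▸ 13330 ▸ 13666 ▸ 1005 ▸ 8541 ▸
  8666 ▸ qed)) (4326 ▸ 3866 ▸ 3941 ▸ 4181 ▸ 4316 ▸ 4191 ▸ 4176 ▸ 3816 ▸ 13566 ▸ 13551 ▸ 13191 ▸ 7306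
  ▸ 7081 ▸ 7066 ▸ 7441 ▸ 13691 ▸ 6941 ▸ 7316 ▸ 9755 ▸ 11041 ▸ 7836 ▸ 8516 ▸ 2255 ▸ 8566 ▸ 2005 ▸
  9316 ▸ 8816 ▸ 9191 ▸ 7931 ▸ qed)) (13166 ▸ 13526 ▸ 7281 ▸ 7041 ▸ 7416 ▸ 6916 ▸ 7276 ▸ 7291 ▸ split
  3751 (10001 ▸ 5001 ▸ 4241 ▸ 7366 ▸ 7451 ▸ 6991 ▸ 10181 ▸ 7306 ▸ 7066 ▸ 7491 ▸ 7441 ▸ 455 ▸ 6941 ▸
  7316 ▸ 4841 ▸ 10936 ▸ 2316 ▸ 2255 ▸ 8566 ▸ 2005 ▸ 9316 ▸ 8816 ▸ 9191 ▸ 7931 ▸ qed) (4326 ▸ 3866 ▸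
  3941 ▸ 4181 ▸ 4316 ▸ 13456 ▸ 4191 ▸ 4176 ▸ 13461 ▸ 13451 ▸ 891 ▸ qed))) (split 4061 (4091 ▸ 4211 ▸
  4116 ▸ 4336 ▸ 4181 ▸ 4081 ▸ 3941 ▸ 3961 ▸ 4186 ▸ 4266 ▸ 11251 ▸ 4341 ▸ 10001 ▸ 5001 ▸ 4366 ▸ split
  7156 (7281 ▸ 13716 ▸ 13206 ▸ 12830 ▸ 1881 ▸ 641 ▸ 10616 ▸ 13211 ▸ 13536 ▸ 7491 ▸ 10036 ▸ 10411 ▸
  10306 ▸ 13166 ▸ 13666 ▸ 701 ▸ 1191 ▸ 13191 ▸ 10186 ▸ 7306 ▸ 10586 ▸ 7366 ▸ 3525 ▸ 205 ▸ 11081 ▸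
  4841 ▸ 11556 ▸ 7816 ▸ 8431 ▸ 5311 ▸ 566 ▸ 11676 ▸ 13066 ▸ 9561 ▸ 11686 ▸ 12936 ▸ qed) (13416 ▸
  7466 ▸ 8561 ▸ 10591 ▸ 10186 ▸ split 7686 (11436 ▸ 7936 ▸ 566 ▸ 11316 ▸ 11556 ▸ 11255 ▸ 15366 ▸
  8116 ▸ 15066 ▸ 15116 ▸ 11866 ▸ 11336 ▸ 11461 ▸ 11275 ▸ 2711 ▸ 15330 ▸ 10786 ▸ 15591 ▸ 6036 ▸ 15291
  ▸ 5411 ▸ 2151 ▸ 14041 ▸ qed) (8091 ▸ 11216 ▸ 11836 ▸ 9186 ▸ 8531 ▸ 11831 ▸ 10316 ▸ 8436 ▸ 9156 ▸
  2826 ▸ 8281 ▸ 10916 ▸ 6716 ▸ 7991 ▸ 205 ▸ qed))) (split 7161 (10411 ▸ 10491 ▸ 10291 ▸ 13536 ▸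
  13416 ▸ 7041 ▸ 10161 ▸ 10281 ▸ 7281 ▸ 1166 ▸ 1901 ▸ 13666 ▸ 10541 ▸ 701 ▸ split 7786 (8536 ▸ 8416
  ▸ 12586 ▸ 6366 ▸ 12826 ▸ 6826 ▸ split 4536 (14916 ▸ 14630 ▸ 12416 ▸ 5916 ▸ 11166 ▸ 5291 ▸ 9951 ▸
  3451 ▸ 11791 ▸ 5966 ▸ 1905 ▸ 8216 ▸ 7936 ▸ 11816 ▸ 11211 ▸ 4181 ▸ 1891 ▸ 13206 ▸ qed) (14291 ▸
  6036 ▸ 15541 ▸ 12616 ▸ 5411 ▸ 3211 ▸ 6086 ▸ 2025 ▸ 8576 ▸ 7816 ▸ 14116 ▸ 15566 ▸ 2251 ▸ 3941 ▸
  13326 ▸ qed)) (11041 ▸ 11116 ▸ 9505 ▸ 14956 ▸ 12366 ▸ 13566 ▸ 14650 ▸ 10181 ▸ 12456 ▸ 866 ▸ 11166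
  ▸ 10241 ▸ 11491 ▸ 6055 ▸ 11616 ▸ 11866 ▸ qed)) (13461 ▸ split 1380 (2891 ▸ 2005 ▸ split 7681
  (11831 ▸ 15241 ▸ 11836 ▸ 15366 ▸ 11841 ▸ 15616 ▸ 11580 ▸ 10025 ▸ 11275 ▸ 5025 ▸ split 7056 (10181
  ▸ 7081 ▸ 2316 ▸ 8516 ▸ 10936 ▸ 7836 ▸ 14086 ▸ 14711 ▸ 2136 ▸ qed) (12081 ▸ 391 ▸ 15336 ▸ 14711 ▸
  11741 ▸ 14841 ▸ 13330 ▸ qed)) (9241 ▸ 15441 ▸ 1455 ▸ 10755 ▸ split 7656 (8281 ▸ split 155 (7966 ▸
  205 ▸ 7991 ▸ 11741 ▸ 7836 ▸ 13330 ▸ 8516 ▸ 14841 ▸ 7081 ▸ 14816 ▸ 7366 ▸ 14791 ▸ 14766 ▸ 7341 ▸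
  7266 ▸ 14661 ▸ 14636 ▸ 14686 ▸ 336 ▸ qed) (6716 ▸ 8436 ▸ 12316 ▸ 5181 ▸ 12706 ▸ 14581 ▸ 391 ▸
  15206 ▸ 14711 ▸ 15336 ▸ 14841 ▸ 11741 ▸ 13330 ▸ qed)) (9216 ▸ 13956 ▸ 8436 ▸ 5181 ▸ 9816 ▸ 10441 ▸
  11066 ▸ 9505 ▸ 13566 ▸ 14191 ▸ 10181 ▸ 10936 ▸ 2316 ▸ qed))) (6041 ▸ 9401 ▸ 3201 ▸ 9166 ▸ 6066 ▸
  8281 ▸ 5181 ▸ 12706 ▸ 14581 ▸ 391 ▸ 15206 ▸ 14711 ▸ 15336 ▸ 4816 ▸ 7916 ▸ 13826 ▸ qed)))))))))))))

certificate : Bool → Bool → Refutation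
-- 16 = 1 + 3 * 5 is the plane of the first two unit vectors, monochromatic by the assumed facts
-- alone.
certificate true  true  = 16 ▸ qed
certificate true  false = sumAgrees
certificate false true  = differenceAgrees
certificate false false = neitherAgrees

check-certificate : ∀ b c → check (pairFacts 7 true b c) (certificate b c) ≡ true
check-certificate true  true  = refl
check-certificate true  false = refl
check-certificate false true  = refl
check-certificate false false = refl

-- Squares from a cross-monochromatic pair of parallel cubes

-- Letters of [4] are pairs of signs; opposite negates both components.
letter : Bool → Bool → Fin 4
letter false false = zero
letter false true  = suc zero
letter true  false = suc (suc zero)
letter true  true  = suc (suc (suc zero))

component : Bool → Fin 4 → Bool
component true  zero                   = false
component true  (suc zero)             = false
component true  (suc (suc zero))       = true
component true  (suc (suc (suc zero))) = true
component false zero                   = false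
component false (suc zero)             = true
component false (suc (suc zero))       = false
component false (suc (suc (suc zero))) = true

letter-component : ∀ a → letter (component true a) (component false a) ≡ a
letter-component zero                   = refl
letter-component (suc zero)             = refl
letter-component (suc (suc zero))       = refl
letter-component (suc (suc (suc zero))) = refl

select : ∀ {A : Set} → Bool → A → A → A
select true  x y = x
select false x y = y

component-letter : ∀ b x y → component b (letter x y) ≡ select b x y
component-letter true  false false = refl
component-letter true  false true  = refl
component-letter true  true  false = refl
component-letter true  true  true  = refl
component-letter false false false = refl
component-letter false false true  = refl
component-letter false true  false = refl
component-letter false true  true  = refl

component-act : ∀ b σ a → component b (tttAct σ a) ≡ grAct σ (component b a)
component-act b false a = refl
component-act true  true zero                   = refl
component-act true  true (suc zero)             = refl
component-act true  true (suc (suc zero))       = refl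
component-act true  true (suc (suc (suc zero))) = refl
component-act false true zero                   = refl
component-act false true (suc zero)             = refl
component-act false true (suc (suc zero))       = refl
component-act false true (suc (suc (suc zero))) = refl

grAct-xor : ∀ σ ρ x → grAct (σ xor ρ) x ≡ grAct σ (grAct ρ x)
grAct-xor false ρ     x = refl
grAct-xor true  false x = refl
grAct-xor true  true  x = sym (Bool.not-involutive x)

grAct-injective : ∀ σ → Injective _≡_ _≡_ (grAct σ)
grAct-injective false eq = eq
grAct-injective true  eq = Bool.not-injective eq

half : ∀ {d} → Bool → Entry (Fin 4) Bool d → Entry Bool Bool d
half b (const a) = const (component b a)
half b (var σ j) = var σ j

-- Constants and reflections act on the two components separately, so one half of a point depends on
-- `p` alone and the other on `q` alone. As `p` and `q` vary independently, one monochromatic space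
-- controls every cross edge between the two cubes.
component-paramMap : ∀ {d n} b (spec : Vec (Entry (Fin 4) Bool d) n) p q →
  map (component b) (paramMap tttAct spec (zipWith letter p q)) ≡ paramMap grAct (map (half b) spec) (select b p q)
component-paramMap b []       p q = refl
component-paramMap b (e ∷ es) p q = cong₂ _∷_ (component-entry e) (component-paramMap b es p q)
  where
  lookup-select : ∀ b j → select b (lookup p j) (lookup q j) ≡ lookup (select b p q) j
  lookup-select true  j = refl
  lookup-select false j = refl

  component-entry : ∀ e → component b (evalEntry tttAct e (zipWith letter p q)) ≡
                          evalEntry grAct (half b e) (select b p q)
  component-entry (const a) = refl
  component-entry (var σ j) = trans (component-act b σ _)
    (cong (grAct σ) (trans (cong (component b) (Vec.lookup-zipWith letter j p q))
      (trans (component-letter b (lookup p j) (lookup q j)) (lookup-select b j))))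

zipWith-component : ∀ {n} (w : Vec (Fin 4) n) →
  zipWith letter (map (component true) w) (map (component false) w) ≡ w
zipWith-component []      = refl
zipWith-component (a ∷ w) = cong₂ _∷_ (letter-component a) (zipWith-component w)

map-component-zipWith : ∀ {n} b (p q : Vec Bool n) → map (component b) (zipWith letter p q) ≡ select b p q
map-component-zipWith true  []      []      = refl
map-component-zipWith false []      []      = refl
map-component-zipWith true  (x ∷ p) (y ∷ q) = cong₂ _∷_ (component-letter true x y) (map-component-zipWith true p q)
map-component-zipWith false (x ∷ p) (y ∷ q) = cong₂ _∷_ (component-letter false x y) (map-component-zipWith false p q)

-- Edges and squares inside a cube

coordinate : Maybe Bool → Bool → Bool → Bool
coordinate nothing  x s = x
coordinate (just σ) x s = grAct σ s

-- Coordinates in the support of `δ` are overwritten, so the base point `u` matters only outside the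
-- support; the two values of `s` give the two ends of the edge.
endpoint : ∀ {d} → Vec Bool d → Direction d → Bool → Vec Bool d
endpoint u δ s = zipWith (λ x m → coordinate m x s) u δ

endpoint-injective : ∀ {d} (u : Vec Bool d) {δ} → Any Is-just δ → Injective _≡_ _≡_ (endpoint u δ)
endpoint-injective (x ∷ u) {just σ ∷ δ} (here _)  eq = grAct-injective σ (Vec.∷-injectiveˡ eq)
endpoint-injective (x ∷ u) {m ∷ δ}      (there p) eq = endpoint-injective u p (Vec.∷-injectiveʳ eq)

fillCell : Maybe (Fin 2 × Bool) → Entry Bool Bool 2
fillCell nothing        = const false
fillCell (just (j , σ)) = var σ j

fill : ∀ {d} → Plane d → Vec Bool 2 → Vec Bool d
fill γ = paramMap grAct (map fillCell γ)

fill-injective : ∀ {d} {γ : Plane d} → Proper γ → Injective _≡_ _≡_ (fill γ)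
fill-injective (p , q) {x ∷ y ∷ []} {x′ ∷ y′ ∷ []} eq =
  cong₂ (λ x y → x ∷ y ∷ []) (component-eq p eq) (component-eq q eq)
  where
  component-eq : ∀ {d j} {γ : Plane d} → Any (Moves j) γ → ∀ {x y} → fill γ x ≡ fill γ y → lookup x j ≡ lookup y j
  component-eq {γ = just (_ , σ) ∷ γ} (here refl) eq = grAct-injective σ (Vec.∷-injectiveˡ eq)
  component-eq {γ = _ ∷ γ}            (there p)   eq = component-eq p (Vec.∷-injectiveʳ eq)

move : Coefficients → Vec Bool 2 → Bool → Vec Bool 2
move (k , l) (x ∷ y ∷ []) s = coordinate k x s ∷ coordinate l y s ∷ []

-- Signs compose and unmoved coordinates stay, so an edge in direction `γ · k` based at a point of
-- the plane is a side or a diagonal of the filled square.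
endpoint-fill : ∀ {d} (γ : Plane d) k w s → endpoint (fill γ w) (γ · k) s ≡ fill γ (move k w s)
endpoint-fill []      k w s = refl
endpoint-fill (m ∷ γ) k w s = cong₂ _∷_ (cell m k w) (endpoint-fill γ k w s)
  where
  act : ∀ σ k x → coordinate (Maybe.map (σ xor_) k) (grAct σ x) s ≡ grAct σ (coordinate k x s)
  act σ nothing  x = refl
  act σ (just ρ) x = grAct-xor σ ρ s

  cell : ∀ m k w → coordinate (scale k m) (evalEntry grAct (fillCell m) w) s ≡
                   evalEntry grAct (fillCell m) (move k w s)
  cell nothing               k       w            = refl
  cell (just (zero     , σ)) (k , l) (x ∷ y ∷ []) = act σ k x
  cell (just (suc zero , σ)) (k , l) (x ∷ y ∷ []) = act σ l y

compose : ∀ {d k} → Vec (Entry Bool Bool k) d → Entry Bool Bool d → Entry Bool Bool k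
compose γ (const a) = const a
compose γ (var σ j) with lookup γ j
... | const a = const (grAct σ a)
... | var ρ i = var (σ xor ρ) i

compose-eval : ∀ {d k} (γ : Vec (Entry Bool Bool k) d) e x →
               evalEntry grAct e (paramMap grAct γ x) ≡ evalEntry grAct (compose γ e) x
compose-eval γ (const a) x = refl
compose-eval γ (var σ j) x rewrite Vec.lookup-map j (λ e → evalEntry grAct e x) γ with lookup γ j
... | const a = refl
... | var ρ i = sym (grAct-xor σ ρ (lookup x i))

compose-paramMap : ∀ {d k n} (spec : Vec (Entry Bool Bool d) n) (γ : Vec (Entry Bool Bool k) d) x →
                   paramMap grAct spec (paramMap grAct γ x) ≡ paramMap grAct (map (compose γ) spec) x
compose-paramMap []         γ x = refl
compose-paramMap (e ∷ spec) γ x = cong₂ _∷_ (compose-eval γ e x) (compose-paramMap spec γ x)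

-- Excludes zero directions, whose edges have coinciding ends and would give a degenerate prism. The
-- supports of the generators are disjoint, so a coordinate moved by the first one survives in the
-- sum and in the difference.
nonzero : ∀ {d} {γ : Plane d} → Proper γ → All (λ k → Any Is-just (γ · k)) coefficients
nonzero (p , q) = generator p (λ _ → just tt) ∷ generator q (λ _ → just tt)
                ∷ generator p (λ _ → just tt) ∷ generator p (λ _ → just tt) ∷ []
  where
  generator : ∀ {d j k} {γ : Plane d} → Any (Moves j) γ → (∀ σ → Is-just (scale k (just (j , σ)))) →
              Any Is-just (γ · k)
  generator {γ = just (_ , σ) ∷ γ} (here refl) h = here (h σ)
  generator {γ = _ ∷ γ}            (there p)   h = there (generator p h)

-- The entry with value `x` where the first parameter is `true` and `y` where it is `false`;
-- negation in the group makes all four cases expressible.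
glue : ∀ {k} → Bool → Bool → Entry Bool Bool (suc k)
glue true  true  = const true
glue true  false = var false zero
glue false true  = var true zero
glue false false = const false

glue-eval : ∀ {k} x y t (v : Vec Bool k) → evalEntry grAct (glue x y) (t ∷ v) ≡ select t x y
glue-eval true  true  true  v = refl
glue-eval true  true  false v = refl
glue-eval true  false true  v = refl
glue-eval true  false false v = refl
glue-eval false true  true  v = refl
glue-eval false true  false v = refl
glue-eval false false true  v = refl
glue-eval false false false v = refl

does-true : ∀ {P : Set} (P? : Dec P) → does P? ≡ true → P
does-true (yes p) _ = p

does-false : ∀ {P : Set} (P? : Dec P) → does P? ≡ false → ¬ P
does-false (no ¬p) _ = ¬p

≢⇒≡opposite : ∀ {i j : Fin 2} → i ≢ j → i ≡ opposite j
≢⇒≡opposite {zero}     {zero}     h = ⊥-elim (h refl)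
≢⇒≡opposite {zero}     {suc zero} h = refl
≢⇒≡opposite {suc zero} {zero}     h = refl
≢⇒≡opposite {suc zero} {suc zero} h = ⊥-elim (h refl)

module _ {n d : ℕ} (ec : Vec Bool (suc n) → Vec Bool (suc n) → Fin 2) (ec-sym : ∀ u v → ec u v ≡ ec v u)
         (spec : Vec (Entry (Fin 4) Bool d) n)
         (spec-injective : Injective _≡_ _≡_ (paramMap tttAct spec)) (col : Fin 2)
         (mono : ∀ w → ec (true  ∷ map (component true) (paramMap tttAct spec w))
                          (false ∷ map (component false) (paramMap tttAct spec w)) ≡ col) where

  cube : Bool → Vec Bool d → Vec Bool (suc n)
  cube b p = b ∷ paramMap grAct (map (half b) spec) p

  -- Fixing the other component at `false` embeds the cube into the tic-tac-toe space. If two points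
  -- have the same image in the cube, their words agree in both components after `paramMap`, and
  -- injectivity of the space applies.
  cube-injective : ∀ b → Injective _≡_ _≡_ (cube b)
  cube-injective b {p} {p′} eq = diagonal b (spec-injective
    (trans (pairing p) (trans (cong₂ (zipWith letter) (tails true) (tails false)) (sym (pairing p′)))))
    where
    word : Vec Bool d → Vec (Fin 4) d
    word p = zipWith letter (select b p (replicate d false)) (select b (replicate d false) p)

    pairing : ∀ p → paramMap tttAct spec (word p) ≡
                  zipWith letter (map (component true) (paramMap tttAct spec (word p)))
                                 (map (component false) (paramMap tttAct spec (word p)))
    pairing p = sym (zipWith-component _)

    tail-eq : ∀ b b′ → paramMap grAct (map (half b) spec) p ≡ paramMap grAct (map (half b) spec) p′ →
      paramMap grAct (map (half b′) spec) (select b′ (select b p (replicate d false)) (select b (replicate d false) p)) ≡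
      paramMap grAct (map (half b′) spec) (select b′ (select b p′ (replicate d false)) (select b (replicate d false) p′))
    tail-eq true  true  eq = eq
    tail-eq true  false eq = refl
    tail-eq false true  eq = refl
    tail-eq false false eq = eq

    tails : ∀ b′ → map (component b′) (paramMap tttAct spec (word p)) ≡
                   map (component b′) (paramMap tttAct spec (word p′))
    tails b′ = trans (component-paramMap b′ spec _ _)
                 (trans (tail-eq b b′ (Vec.∷-injectiveʳ eq)) (sym (component-paramMap b′ spec _ _)))

    diagonal : ∀ b → zipWith letter (select b p (replicate d false)) (select b (replicate d false) p) ≡
                     zipWith letter (select b p′ (replicate d false)) (select b (replicate d false) p′) → p ≡ p′
    diagonal true  eq = trans (sym (map-component-zipWith true p _))
                          (trans (cong (map (component true)) eq) (map-component-zipWith true p′ _))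
    diagonal false eq = trans (sym (map-component-zipWith false _ p))
                          (trans (cong (map (component false)) eq) (map-component-zipWith false _ p′))

  cross : ∀ p q → ec (cube true p) (cube false q) ≡ col
  cross p q = trans (sym (cong₂ (λ u v → ec (true ∷ u) (false ∷ v))
                            (component-paramMap true spec p q) (component-paramMap false spec p q)))
                    (mono (zipWith letter p q))

  MonoSquare : Set
  MonoSquare = ∃[ f ] (IsParamMap {Bool} {Bool} {2} {suc n} grAct f ×
                       ∃[ col ] (∀ x y → x ≢ y → ec (f x) (f y) ≡ col))

  Parallel : Bool → Direction d → Set
  Parallel b δ = ∃[ u ] ec (cube b (endpoint u δ true)) (cube b (endpoint u δ false)) ≡ col

  parallel? : ∀ b δ → Dec (Parallel b δ)
  parallel? b δ = exists? (finite-Vec finite-Bool d) λ u →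
    ec (cube b (endpoint u δ true)) (cube b (endpoint u δ false)) Fin.≟ col

  prism : ∀ δ → Any Is-just δ → (∀ b → Parallel b δ) → MonoSquare
  prism δ δ≢0 edge = square , ((var false zero ∷ map entry spec , isParam) , injective) , col , mono-square
    where
    u : Bool → Vec Bool d
    u b = proj₁ (edge b)

    square : Vec Bool 2 → Vec Bool (suc n)
    square (t ∷ s ∷ []) = cube t (endpoint (u t) δ s)

    entry : Entry (Fin 4) Bool d → Entry Bool Bool 2
    entry (const a) = glue (component true a) (component false a)
    entry (var σ j) with lookup δ j
    ... | nothing = glue (grAct σ (lookup (u true) j)) (grAct σ (lookup (u false) j))
    ... | just ρ  = var (σ xor ρ) (suc zero)

    select-f : ∀ {A C : Set} (f : A → C) (g : Bool → A) t → select t (f (g true)) (f (g false)) ≡ f (g t)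
    select-f f g true  = refl
    select-f f g false = refl

    entry-eval : ∀ e t s → evalEntry grAct (half t e) (endpoint (u t) δ s) ≡ evalEntry grAct (entry e) (t ∷ s ∷ [])
    entry-eval (const a) t s = sym (trans (glue-eval _ _ t _) (select-f id (λ t → component t a) t))
    entry-eval (var σ j) t s rewrite Vec.lookup-zipWith (λ x m → coordinate m x s) j (u t) δ with lookup δ j
    ... | nothing = sym (trans (glue-eval (grAct σ (lookup (u true) j)) _ t _)
                               (select-f (λ v → grAct σ (lookup v j)) u t))
    ... | just ρ  = sym (grAct-xor σ ρ s)

    isParam : ∀ x → square x ≡ paramMap grAct (var false zero ∷ map entry spec) x
    isParam (t ∷ s ∷ []) = cong (t ∷_) (go spec)
      where
      go : ∀ {m} (spec : Vec (Entry (Fin 4) Bool d) m) →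
           paramMap grAct (map (half t) spec) (endpoint (u t) δ s) ≡ paramMap grAct (map entry spec) (t ∷ s ∷ [])
      go []       = refl
      go (e ∷ es) = cong₂ _∷_ (entry-eval e t s) (go es)

    injective : Injective _≡_ _≡_ square
    injective {t ∷ s ∷ []} {t′ ∷ s′ ∷ []} eq with Vec.∷-injectiveˡ eq
    ... | refl = cong (λ s → t ∷ s ∷ []) (endpoint-injective (u t) δ≢0 (cube-injective t eq))

    mono-square : ∀ x y → x ≢ y → ec (square x) (square y) ≡ col
    mono-square (true  ∷ s ∷ []) (false ∷ s′ ∷ []) _ = cross _ _
    mono-square (false ∷ s ∷ []) (true  ∷ s′ ∷ []) _ = trans (ec-sym _ _) (cross _ _)
    mono-square (true  ∷ true  ∷ []) (true  ∷ false ∷ []) _ = proj₂ (edge true)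
    mono-square (true  ∷ false ∷ []) (true  ∷ true  ∷ []) _ = trans (ec-sym _ _) (proj₂ (edge true))
    mono-square (false ∷ true  ∷ []) (false ∷ false ∷ []) _ = proj₂ (edge false)
    mono-square (false ∷ false ∷ []) (false ∷ true  ∷ []) _ = trans (ec-sym _ _) (proj₂ (edge false))
    mono-square (true  ∷ true  ∷ []) (true  ∷ true  ∷ []) h = ⊥-elim (h refl)
    mono-square (true  ∷ false ∷ []) (true  ∷ false ∷ []) h = ⊥-elim (h refl)
    mono-square (false ∷ true  ∷ []) (false ∷ true  ∷ []) h = ⊥-elim (h refl)
    mono-square (false ∷ false ∷ []) (false ∷ false ∷ []) h = ⊥-elim (h refl)

  plane : ∀ b (γ : Plane d) → Proper γ → All (λ k → ¬ Parallel b (γ · k)) coefficients → MonoSquare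
  plane b γ proper (h₁ ∷ h₂ ∷ h₃ ∷ h₄ ∷ []) =
    square , ((const b ∷ map (compose (map fillCell γ)) (map (half b) spec) ,
               λ x → cong (b ∷_) (compose-paramMap (map (half b) spec) (map fillCell γ) x)) ,
              λ eq → fill-injective proper (cube-injective b eq)) ,
    opposite col , λ x y x≢y → ≢⇒≡opposite (distinct x y x≢y)
    where
    square : Vec Bool 2 → Vec Bool (suc n)
    square x = cube b (fill γ x)

    along : ∀ {k} w → ¬ Parallel b (γ · k) → ec (square (move k w true)) (square (move k w false)) ≢ col
    along {k} w h eq = h (fill γ w , subst₂ (λ p q → ec (cube b p) (cube b q) ≡ col)
                                       (sym (endpoint-fill γ k w true)) (sym (endpoint-fill γ k w false)) eq)

    swap : ∀ {x y} → ec (square x) (square y) ≢ col → ec (square y) (square x) ≢ col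
    swap h eq = h (trans (ec-sym _ _) eq)

    distinct : ∀ x y → x ≢ y → ec (square x) (square y) ≢ col
    distinct (true  ∷ t ∷ [])     (false ∷ t′ ∷ [])    _ with t | t′
    -- Only the unmoved coordinate of `w` matters: it places a side, while for a diagonal `w` is
    -- arbitrary.
    ... | true  | true  = along (true ∷ true ∷ []) h₁
    ... | false | false = along (true ∷ false ∷ []) h₁
    ... | true  | false = along (true ∷ true ∷ []) h₃
    ... | false | true  = along (true ∷ true ∷ []) h₄
    distinct (false ∷ t ∷ [])     (true ∷ t′ ∷ [])    _ with t | t′
    ... | true  | true  = swap (along (true ∷ true ∷ []) h₁)
    ... | false | false = swap (along (true ∷ false ∷ []) h₁)
    ... | true  | false = swap (along (true ∷ true ∷ []) h₄)
    ... | false | true  = swap (along (true ∷ true ∷ []) h₃)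
    distinct (true  ∷ t ∷ [])     (true ∷ t′ ∷ [])    x≢y with t | t′
    ... | true  | true  = ⊥-elim (x≢y refl)
    ... | false | false = ⊥-elim (x≢y refl)
    ... | true  | false = along (true ∷ true ∷ []) h₂
    ... | false | true  = swap (along (true ∷ true ∷ []) h₂)
    distinct (false ∷ t ∷ [])     (false ∷ t′ ∷ [])    x≢y with t | t′
    ... | true  | true  = ⊥-elim (x≢y refl)
    ... | false | false = ⊥-elim (x≢y refl)
    ... | true  | false = along (false ∷ true ∷ []) h₂
    ... | false | true  = swap (along (false ∷ true ∷ []) h₂)

  monoSquare : (∀ (χ : Direction d → Bool) → MonoPlane χ) → MonoSquare
  -- The colouring looks at the `true` cube only. If it is constantly `true` on the four directions,
  -- the `false` cube either has an edge of colour `col` in one of them, which gives a prism, or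
  -- avoids all four.
  monoSquare planes with planes (λ δ → does (parallel? true δ))
  ... | γ , proper , false , all = plane true γ proper (All.map (λ {k} → does-false (parallel? true (γ · k))) all)
  ... | γ , proper , true , all = [ id , plane false γ proper ]′ (either coefficients all (nonzero proper))
    where
    either : ∀ ks → All (λ k → does (parallel? true (γ · k)) ≡ true) ks → All (λ k → Any Is-just (γ · k)) ks →
             MonoSquare ⊎ All (λ k → ¬ Parallel false (γ · k)) ks
    either [] [] [] = inj₂ []
    either (k ∷ ks) (eq ∷ eqs) (p ∷ ps) with parallel? false (γ · k) | either ks eqs ps
    ... | yes e | _      = inj₁ (prism (γ · k) p (λ { true → does-true (parallel? true (γ · k)) eq ; false → e }))
    ... | no _  | inj₁ s = inj₁ s
    ... | no ¬e | inj₂ h = inj₂ (¬e ∷ h)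

GrProp-suc : ∀ {d n} → (∀ (χ : Direction d → Bool) → MonoPlane χ) → TTTProp 4 2 d n → GrProp (suc n)
GrProp-suc planes ttt (ec , ec-sym)
  with ttt (λ w → ec (true ∷ map (component true) w) (false ∷ map (component false) w))
... | f , ((spec , f≗) , inj) , col , mono =
  monoSquare ec ec-sym spec (λ {x} {y} eq → inj (trans (f≗ x) (trans eq (sym (f≗ y))))) col
    (λ w → subst (λ v → ec (true ∷ map (component true) v) (false ∷ map (component false) v) ≡ col)
                 (f≗ w) (mono w))
    planes

-- Normalising the colours and bounding the dimension

agrees : Bool → Bool → Bool
agrees a b = not (a xor b)

agrees-refl : ∀ a → agrees a a ≡ true
agrees-refl true  = refl
agrees-refl false = refl

agrees-involutive : ∀ a b → agrees a (agrees a b) ≡ b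
agrees-involutive true  b = trans (cong not (Bool.not-involutive (not b))) (Bool.not-involutive b)
agrees-involutive false b = Bool.not-involutive b

PairColours : ∀ {n} → (Direction n → Bool) → Bool → Bool → Bool → Set
PairColours {n} χ b₁ b₂ b₃ = ∀ (τ : Thin 2 n) →
  χ (pad ○ τ (⊕ ∷ ○ ∷ [])) ≡ b₁ × χ (pad ○ τ (⊕ ∷ ⊕ ∷ [])) ≡ b₂ × χ (pad ○ τ (⊕ ∷ ⊖ ∷ [])) ≡ b₃

extends-pairFacts : ∀ {n χ b₁ b₂ b₃} → PairColours {n} χ b₁ b₂ b₃ → Extends χ (pairFacts n b₁ b₂ b₃)
extends-pairFacts {n} pairs = All.concat⁺ (All.map⁺ (All.universal
  (λ τ → let (eq₁ , eq₂ , eq₃) = pairs τ in eq₁ ∷ eq₂ ∷ eq₃ ∷ []) (thinnings 2 n)))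

monoPlane₇ : ∀ χ b c → PairColours {7} χ true b c → MonoPlane χ
monoPlane₇ χ b c pairs =
  check-sound χ (extends-pairFacts {7} {χ} {true} {b} {c} pairs) (certificate b c) (check-certificate b c)

-- The colour of eᵢ is presented as a colouring of pairs i < j that ignores j, so that `ramsey³`
-- treats all three colourings alike; the last unit vector consequently gets no prescribed colour.
homogeneous-pairs : ∀ {m n} b → m ≤ 2 ↑↑ b → 2 ↑↑ (6 + b) ≤ n → ∀ (χ : Direction n → Bool) →
  ∃[ θ ] (∃[ b₁ ] ∃[ b₂ ] ∃[ b₃ ] PairColours {m} (χ ∘ pad ○ θ) b₁ b₂ b₃)
homogeneous-pairs b m≤ ≤n χ
  with ramsey³ b m≤ ≤n (λ τ → χ (pad ○ τ (⊕ ∷ ○ ∷ []))) (λ τ → χ (pad ○ τ (⊕ ∷ ⊕ ∷ [])))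
                       (λ τ → χ (pad ○ τ (⊕ ∷ ⊖ ∷ [])))
... | θ , b₁ , b₂ , b₃ , pairs = θ , b₁ , b₂ , b₃ , λ τ →
  let (eq₁ , eq₂ , eq₃) = pairs τ
      pull : ∀ v {b} → χ (pad ○ (θ ⊙ τ) v) ≡ b → χ (pad ○ θ (pad ○ τ v)) ≡ b
      pull v eq = trans (cong χ (sym (pad-⊙ ○ θ τ v))) eq
  in pull _ eq₁ , pull _ eq₂ , pull _ eq₃

-- Recolouring by `agrees` with the colour of the unit vectors makes that colour `true`, which
-- reduces eight patterns to the four that have certificates.
relabel : ∀ {n} a {χ : Direction n → Bool} → MonoPlane (agrees a ∘ χ) → MonoPlane χ
relabel a (γ , proper , b , mono) =
  γ , proper , agrees a b , All.map (λ eq → trans (sym (agrees-involutive a _)) (cong (agrees a) eq)) mono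

pairColours-agrees : ∀ {n χ a b c} → PairColours {n} χ a b c →
  PairColours {n} (agrees a ∘ χ) true (agrees a b) (agrees a c)
pairColours-agrees {a = a} pairs τ =
  let eq₁ , eq₂ , eq₃ = pairs τ
  in trans (cong (agrees a) eq₁) (agrees-refl a) , cong (agrees a) eq₂ , cong (agrees a) eq₃

monoPlane : ∀ {d} b → 7 ≤ 2 ↑↑ b → 2 ↑↑ (6 + b) ≤ d → ∀ (χ : Direction d → Bool) → MonoPlane χ
monoPlane {d} b 7≤ ≤d χ = conclude (homogeneous-pairs b 7≤ ≤d χ)
  where
  conclude : ∃[ θ ] (∃[ b₁ ] ∃[ b₂ ] ∃[ b₃ ] PairColours {7} (χ ∘ pad ○ θ) b₁ b₂ b₃) → MonoPlane χ
  conclude (θ , b₁ , b₂ , b₃ , pairs) = monoPlane-pad θ {χ} (relabel b₁ {χ ∘ pad ○ θ}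
    (monoPlane₇ (agrees b₁ ∘ χ ∘ pad ○ θ) (agrees b₁ b₂) (agrees b₁ b₃)
      (pairColours-agrees {7} {χ ∘ pad ○ θ} {b₁} {b₂} {b₃} pairs)))

-- The second search starts from the least `T` found by the first, so the bound on `g` involves `T`
-- and not the far larger witness that existence provides.
leasts : ∀ {P Q : ℕ → Set} → Decidable P → Decidable Q → ∃ Q → (∀ n → Q n → P (n + 1)) →
         ∃[ g ] ∃[ T ] (IsLeast P g × IsLeast Q T × g ≤ T + 1)
leasts P? Q? (n , q) step with least Q? n q
... | T , isT , _ with least P? (T + 1) (step T (proj₁ isT))
... | g , isg , g≤ = g , T , isg , isT , g≤

grBound : ∀ {b d} → 7 ≤ 2 ↑↑ b → 2 ↑↑ (6 + b) ≤ d → GrBound d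
grBound {b} {d} 7≤ ≤d = leasts GrProp? (TTTProp? 4 2 d) (tttProp {4} {d} 2 (replicate d zero))
  (λ n ttt → subst GrProp (ℕ.+-comm 1 n) (GrProp-suc (monoPlane b 7≤ ≤d) ttt))

-- With the heights as variables the towers stay symbolic, and `2 ↑↑ 18` arises only as an instance.
grBound-↑↑ : ∀ a b → 7 ≤ 2 ↑↑ a → 6 + a ≤ b → 0 < 2 ↑↑ b × GrBound (2 ↑↑ b)
grBound-↑↑ a b 7≤ h = ↑↑-mono-≤ {0} {b} z≤n , grBound {a} 7≤ (↑↑-mono-≤ h)

theorem1p4 : (∃[ d ] (0 < d × GrBound d)) × GrBound (2 ↑↑ 18)
theorem1p4 = (2 ↑↑ 18 , proj₁ bound , proj₂ bound) , proj₂ bound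
  where
  bound : 0 < 2 ↑↑ 18 × GrBound (2 ↑↑ 18)
  -- `2 ↑↑ 3` is 16, the first tower with room for seven coordinates; three rounds of Ramsey raise
  -- the height to 6 + 3 = 9, which is at most 18.
  bound = grBound-↑↑ 3 18 (ℕ.≤ᵇ⇒≤ 7 16 tt) (ℕ.≤ᵇ⇒≤ 9 18 tt)
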